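{- Let $(x^0,C)$ be an instance of the $2$-facility reallocation problem on the real line with $x_1^0\le x_2^0$, let $x=\{(x_1^t,x_2^t)\}_{t\ge1}$ be the solution produced by the online algorithm described in the context, and let $x^*$ be an optimal (offline) solution, i.e. a minimizer of $Cost$. Then $$Cost(x)\le 63\cdot Cost(x^*)+|x_1^0-x_2^0| .$$
   Context: $2$-facility reallocation problem: an instance is $(x^0,C)$ with $x^0=(x_1^0,x_2^0)\in\mathbb R^2$ the initial facility positions and $C=(C_1,\dots,C_T)$, where $C_t=\{\alpha_1^t\le\dots\le\alpha_n^t\}$ are the positions on the real line of the $n$ agents at stage $t$ (with multiplicity), ordered from left to right. A solution is $x=(x^1,\dots,x^T)$ with $x^t=(x_1^t,x_2^t)\in\mathbb R^2$, and $$Cost(x)=\sum_{t=1}^T\Big[\sum_{k=1}^2|x_k^t-x_k^{t-1}|+\sum_{i=1}^n\min_{k=1,2}|\alpha_i^t-x_k^t|\Big].$$ In the online setting $C_t$ is revealed only after $x^{t-1}$ has been fixed. Notation: for a finite non-empty multiset $D$ of positions, $M_D$ is its median (if $|D|$ is odd) or its median interval (the interval between the two middle elements, if $|D|$ is even); "placing a facility at $M_D$" means placing it at the median, resp. at some point of the median interval. $H(D)=\sum_{\alpha\in D}|\alpha-M_D|$ is the optimal connection cost of $D$ to a single facility (in the even case, the sum of distances to any point of $M_D$), and $H(\emptyset)=0$. Online algorithm at stage $t\ge1$, given $x_1^{t-1}\le x_2^{t-1}$ and $C_t$: Step 1. Set $z_1\leftarrow x_1^{t-1}$, $z_2\leftarrow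 x_2^{t-1}$. If $z_1>\alpha_n^t$, set $z_1\leftarrow\alpha_n^t$. If $z_2<\alpha_1^t$, set $z_2\leftarrow\alpha_1^t$. If $z_1<\alpha_1^t$ and $z_2>\alpha_n^t$, let $\delta=\min(|x_1^{t-1}-\alpha_1^t|,|x_2^{t-1}-\alpha_n^t|)$ and set $z_1\leftarrow z_1+\delta$, $z_2\leftarrow z_2-\delta$. Step 2. (a) If $\alpha_1^t\le z_1\le\alpha_n^t$ and $z_2-\alpha_n^t\ge 3H(C_t)$: place $x_1^t$ at $M_{C_t}$ and set $x_2^t=z_2-3H(C_t)$. (b) Else if $\alpha_1^t\le z_2\le\alpha_n^t$ and $\alpha_1^t-z_1\ge3H(C_t)$: set $x_1^t=z_1+3H(C_t)$ and place $x_2^t$ at $M_{C_t}$. (c) Otherwise: compute a partition $(O_1,O_2)$ of $C_t$ into a left part $O_1$ and a right part $O_2$ minimizing the two-facility connection cost $H(O_1)+H(O_2)$, and place $x_1^t$ at $M_{O_1}$ and $x_2^t$ at $M_{O_2}$. -}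

module Defs where

open import Algebra.Bundles.Raw using (RawMonoid)
open import Algebra.Definitions.RawMonoid using () renaming (_×_ to multiple)
open import Data.Fin.Base using (Fin; suc; inject₁; fromℕ<)
open import Data.List.Base as List using (List; []; _∷_; _++_; length; lookup)
open import Data.Nat.Base as ℕ using (ℕ; suc; s≤s; ⌊_/2⌋; ⌈_/2⌉)
import Data.Nat.Properties as ℕₚ
open import Data.Product.Base using (_×_; _,_; proj₁; proj₂; ∃-syntax)
open import Data.Rational.Base as ℚ using (ℚ; 0ℚ; ½)
import Data.Rational.Properties as ℚₚ
open import Data.Rational.Solver using (module +-*-Solver)
open import Data.Sum.Base using (inj₁; inj₂)
open import Data.Unit.Base using (⊤)
open import Data.Vec.Base as Vec using (Vec; toList)
open import Data.Vec.Functional as Vector using (Vector)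
open import Data.Vec.Relation.Unary.Linked using (Linked)
open import Level using (0ℓ)
open import Relation.Binary.PropositionalEquality
  using (_≡_; refl; sym; trans; cong; subst; subst₂)
open import Relation.Nullary.Negation.Core using (¬_)

------------------------------------------------------------------------
-- Real numbers, as Cauchy sequences of rationals considered up to _≃_

record ℝ : Set where
  field
    seq    : ℕ → ℚ
    cauchy : ∀ ε → 0ℚ ℚ.< ε →
             ∃[ N ] ∀ m n → N ℕ.≤ m → N ℕ.≤ n → ℚ.∣ seq m ℚ.- seq n ∣ ℚ.≤ ε

open ℝ public

infix  4 _≤_ _<_ _≃_
infixl 6 _+_ _-_
infixl 7 _⊓_ _·_
infix  8 -_

_≤_ : ℝ → ℝ → Set
x ≤ y = ∀ ε → 0ℚ ℚ.< ε → ∃[ N ] ∀ n → N ℕ.≤ n → seq x n ℚ.≤ seq y n ℚ.+ ε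

_<_ : ℝ → ℝ → Set
x < y = ∃[ ε ] 0ℚ ℚ.< ε × ∃[ N ] ∀ n → N ℕ.≤ n → seq x n ℚ.+ ε ℚ.≤ seq y n

_≃_ : ℝ → ℝ → Set
x ≃ y = x ≤ y × y ≤ x

private
  open +-*-Solver

  ½-pos : ∀ {ε} → 0ℚ ℚ.< ε → 0ℚ ℚ.< ½ ℚ.* ε
  ½-pos {ε} 0<ε = subst (ℚ._< ½ ℚ.* ε) (ℚₚ.*-zeroʳ ½) (ℚₚ.*-monoʳ-<-pos ½ 0<ε)

  halves : ∀ ε → ½ ℚ.* ε ℚ.+ ½ ℚ.* ε ≡ ε
  halves = solve 1 (λ e → con ½ :* e :+ con ½ :* e := e) refl

  p≤∣p∣ : ∀ p → p ℚ.≤ ℚ.∣ p ∣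
  p≤∣p∣ p with ℚₚ.≤-total 0ℚ p
  ... | inj₁ 0≤p = ℚₚ.≤-reflexive (sym (ℚₚ.0≤p⇒∣p∣≡p 0≤p))
  ... | inj₂ p≤0 = ℚₚ.≤-trans p≤0 (ℚₚ.0≤∣p∣ p)

  shift : ∀ p q → q ℚ.+ (p ℚ.- q) ≡ p
  shift = solve 2 (λ p q → q :+ (p :- q) := p) refl

  flip : ∀ p q → ℚ.- (p ℚ.- q) ≡ q ℚ.- p
  flip = solve 2 (λ p q → :- (p :- q) := q :- p) refl

  ∣p-q∣≡∣q-p∣ : ∀ p q → ℚ.∣ p ℚ.- q ∣ ≡ ℚ.∣ q ℚ.- p ∣
  ∣p-q∣≡∣q-p∣ p q =
    trans (sym (ℚₚ.∣-p∣≡∣p∣ (p ℚ.- q))) (cong ℚ.∣_∣ (flip p q))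

  close⇒≤ : ∀ {p q ε} → ℚ.∣ p ℚ.- q ∣ ℚ.≤ ε → p ℚ.≤ q ℚ.+ ε
  close⇒≤ {p} {q} c = subst (ℚ._≤ q ℚ.+ _) (shift p q)
    (ℚₚ.+-monoʳ-≤ q (ℚₚ.≤-trans (p≤∣p∣ (p ℚ.- q)) c))

  ≤⇒diff≤ : ∀ {p q ε} → p ℚ.≤ q ℚ.+ ε → p ℚ.- q ℚ.≤ ε
  ≤⇒diff≤ {p} {q} {ε} le = subst (p ℚ.- q ℚ.≤_)
    (solve 2 (λ q e → (q :+ e) :- q := e) refl q ε)
    (ℚₚ.+-monoˡ-≤ (ℚ.- q) le)

  ≤⇒close : ∀ {p q ε} → p ℚ.≤ q ℚ.+ ε → q ℚ.≤ p ℚ.+ ε → ℚ.∣ p ℚ.- q ∣ ℚ.≤ ε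
  ≤⇒close {p} {q} {ε} p≤ q≤ with ℚₚ.∣p∣≡p∨∣p∣≡-p (p ℚ.- q)
  ... | inj₁ eq = subst (ℚ._≤ ε) (sym eq) (≤⇒diff≤ p≤)
  ... | inj₂ eq = subst (ℚ._≤ ε) (sym (trans eq (flip p q))) (≤⇒diff≤ q≤)

  +-close : ∀ {p q r s ε} → ℚ.∣ p ℚ.- r ∣ ℚ.≤ ½ ℚ.* ε → ℚ.∣ q ℚ.- s ∣ ℚ.≤ ½ ℚ.* ε →
            ℚ.∣ (p ℚ.+ q) ℚ.- (r ℚ.+ s) ∣ ℚ.≤ ε
  +-close {p} {q} {r} {s} {ε} c d = subst₂ ℚ._≤_
    (cong ℚ.∣_∣ (solve 4 (λ p q r s → (p :- r) :+ (q :- s) := (p :+ q) :- (r :+ s))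
                         refl p q r s))
    (halves ε)
    (ℚₚ.≤-trans (ℚₚ.∣p+q∣≤∣p∣+∣q∣ (p ℚ.- r) (q ℚ.- s)) (ℚₚ.+-mono-≤ c d))

  neg-close : ∀ {p q ε} → ℚ.∣ p ℚ.- q ∣ ℚ.≤ ε → ℚ.∣ ℚ.- p ℚ.- (ℚ.- q) ∣ ℚ.≤ ε
  neg-close {p} {q} = subst (ℚ._≤ _) (trans (∣p-q∣≡∣q-p∣ p q)
    (cong ℚ.∣_∣ (solve 2 (λ p q → q :- p := (:- p) :- (:- q)) refl p q)))

  abs-≤ : ∀ {p q ε} → ℚ.∣ p ℚ.- q ∣ ℚ.≤ ε → ℚ.∣ p ∣ ℚ.≤ ℚ.∣ q ∣ ℚ.+ ε
  abs-≤ {p} {q} c = subst (λ r → ℚ.∣ r ∣ ℚ.≤ _) (shift p q)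
    (ℚₚ.≤-trans (ℚₚ.∣p+q∣≤∣p∣+∣q∣ q (p ℚ.- q)) (ℚₚ.+-monoʳ-≤ ℚ.∣ q ∣ c))

  abs-close : ∀ {p q ε} → ℚ.∣ p ℚ.- q ∣ ℚ.≤ ε → ℚ.∣ ℚ.∣ p ∣ ℚ.- ℚ.∣ q ∣ ∣ ℚ.≤ ε
  abs-close {p} {q} c =
    ≤⇒close (abs-≤ {p} {q} c) (abs-≤ {q} {p} (subst (ℚ._≤ _) (∣p-q∣≡∣q-p∣ p q) c))

  ⊓-≤ : ∀ {p q r s ε} → p ℚ.≤ r ℚ.+ ε → q ℚ.≤ s ℚ.+ ε → p ℚ.⊓ q ℚ.≤ (r ℚ.⊓ s) ℚ.+ ε
  ⊓-≤ {r = r} {s} {ε} c d = subst (_ ℚ.≤_)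
    (sym (ℚₚ.mono-≤-distrib-⊓ (ℚₚ.+-monoˡ-≤ ε) r s)) (ℚₚ.⊓-mono-≤ c d)

  ⊓-close : ∀ {p q r s ε} → ℚ.∣ p ℚ.- r ∣ ℚ.≤ ε → ℚ.∣ q ℚ.- s ∣ ℚ.≤ ε →
            ℚ.∣ (p ℚ.⊓ q) ℚ.- (r ℚ.⊓ s) ∣ ℚ.≤ ε
  ⊓-close {p} {q} {r} {s} c d = ≤⇒close {p ℚ.⊓ q} {r ℚ.⊓ s}
    (⊓-≤ {p} {q} {r} {s} (close⇒≤ {p} {r} c) (close⇒≤ {q} {s} d))
    (⊓-≤ {r} {s} {p} {q}
      (close⇒≤ {r} {p} (subst (ℚ._≤ _) (∣p-q∣≡∣q-p∣ p r) c))
      (close⇒≤ {s} {q} (subst (ℚ._≤ _) (∣p-q∣≡∣q-p∣ q s) d)))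

0ℝ : ℝ
seq    0ℝ _      = 0ℚ
cauchy 0ℝ ε 0<ε = 0 , λ _ _ _ _ → ℚₚ.<⇒≤ 0<ε

_+_ : ℝ → ℝ → ℝ
seq    (x + y) n = seq x n ℚ.+ seq y n
cauchy (x + y) ε 0<ε =
  let M , p = cauchy x (½ ℚ.* ε) (½-pos 0<ε)
      N , q = cauchy y (½ ℚ.* ε) (½-pos 0<ε)
  in M ℕ.⊔ N , λ m n m≥ n≥ →
     +-close {seq x m} {seq y m} {seq x n} {seq y n}
       (p m n (ℕₚ.m⊔n≤o⇒m≤o M N m≥) (ℕₚ.m⊔n≤o⇒m≤o M N n≥))
       (q m n (ℕₚ.m⊔n≤o⇒n≤o M N m≥) (ℕₚ.m⊔n≤o⇒n≤o M N n≥))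

-_ : ℝ → ℝ
seq    (- x) n = ℚ.- seq x n
cauchy (- x) ε 0<ε =
  let N , p = cauchy x ε 0<ε
  in N , λ m n m≥ n≥ → neg-close {seq x m} {seq x n} (p m n m≥ n≥)

_-_ : ℝ → ℝ → ℝ
x - y = x + (- y)

∣_∣ : ℝ → ℝ
seq    ∣ x ∣ n = ℚ.∣ seq x n ∣
cauchy ∣ x ∣ ε 0<ε =
  let N , p = cauchy x ε 0<ε
  in N , λ m n m≥ n≥ → abs-close {seq x m} {seq x n} (p m n m≥ n≥)

_⊓_ : ℝ → ℝ → ℝ
seq    (x ⊓ y) n = seq x n ℚ.⊓ seq y n
cauchy (x ⊓ y) ε 0<ε =
  let M , p = cauchy x ε 0<ε
      N , q = cauchy y ε 0<ε
  in M ℕ.⊔ N , λ m n m≥ n≥ →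
     ⊓-close {seq x m} {seq y m} {seq x n} {seq y n}
       (p m n (ℕₚ.m⊔n≤o⇒m≤o M N m≥) (ℕₚ.m⊔n≤o⇒m≤o M N n≥))
       (q m n (ℕₚ.m⊔n≤o⇒n≤o M N m≥) (ℕₚ.m⊔n≤o⇒n≤o M N n≥))

+-0-rawMonoid : RawMonoid 0ℓ 0ℓ
+-0-rawMonoid = record { Carrier = ℝ ; _≈_ = _≃_ ; _∙_ = _+_ ; ε = 0ℝ }

_·_ : ℕ → ℝ → ℝ
_·_ = multiple +-0-rawMonoid

sum : List ℝ → ℝ
sum = List.foldr _+_ 0ℝ

------------------------------------------------------------------------
-- Instances, solutions and their cost

-- There are suc n agents, so that the leftmost and rightmost ones exist.
-- Stage t ∈ {1,…,T} is represented by the index t - 1 : Fin T.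
record Instance (n T : ℕ) : Set where
  field
    initial : ℝ × ℝ
    agents  : Fin T → Vec ℝ (suc n)
    ordered : ∀ t → Linked _≤_ (agents t)

open Instance public

Solution : ℕ → Set
Solution T = Vector (ℝ × ℝ) T

-- The facility positions before stage t: the initial ones for the first
-- stage, those of the preceding stage afterwards.
previous : ∀ {T} → ℝ × ℝ → Solution T → Fin T → ℝ × ℝ
previous x⁰ x t = (x⁰ Vector.∷ x) (inject₁ t)

movementCost : ℝ × ℝ → ℝ × ℝ → ℝ
movementCost (y₁ , y₂) (x₁ , x₂) = ∣ x₁ - y₁ ∣ + ∣ x₂ - y₂ ∣

connectionCost : ∀ {n} → Vec ℝ n → ℝ × ℝ → ℝ
connectionCost C (x₁ , x₂) =
  sum (List.map (λ α → ∣ α - x₁ ∣ ⊓ ∣ α - x₂ ∣) (toList C))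

Cost : ∀ {n T} → Instance n T → Solution T → ℝ
Cost I x = sum (List.tabulate λ t →
  movementCost (previous (initial I) x t) (x t) + connectionCost (agents I t) (x t))

IsOptimal : ∀ {n T} → Instance n T → Solution T → Set
IsOptimal I x = ∀ y → Cost I x ≤ Cost I y

------------------------------------------------------------------------
-- Medians.  Lists of positions are in nondecreasing order here.

-- The two middle elements of α ∷ D; they are the same one if its length
-- is odd.
lowerMedian upperMedian : ℝ → List ℝ → ℝ
lowerMedian α D = lookup (α ∷ D) (fromℕ< (s≤s (ℕₚ.⌊n/2⌋≤n (length D))))
upperMedian α D = lookup (α ∷ D) (fromℕ< (s≤s (ℕₚ.⌈n/2⌉≤n (length D))))

-- M_∅ is undefined, and nothing is required when D is empty.  The algorithm
-- never places a facility at M_∅: if some part of an optimal partition of C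
-- is empty then all agents are at the same position, H C = 0, and Step 2 (a)
-- or (b) applies.
infix 4 _PlacedAtMedianOf_

_PlacedAtMedianOf_ : ℝ → List ℝ → Set
x PlacedAtMedianOf []      = ⊤
x PlacedAtMedianOf (α ∷ D) = lowerMedian α D ≤ x × x ≤ upperMedian α D

-- Any point of the median interval gives the same sum of distances.
H : List ℝ → ℝ
H []      = 0ℝ
H (α ∷ D) = sum (List.map (λ β → ∣ β - lowerMedian α D ∣) (α ∷ D))

record IsOptimalPartition (C O₁ O₂ : List ℝ) : Set where
  field
    partition : O₁ ++ O₂ ≡ C
    minimal   : ∀ P₁ P₂ → P₁ ++ P₂ ≡ C → H O₁ + H O₂ ≤ H P₁ + H P₂

------------------------------------------------------------------------
-- The online algorithm.  It is a relation between the facility positions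
-- before and after a stage, since comparison of reals is not decidable and
-- medians and optimal partitions need not be unique.

infixr 1 If_Then_Else_

If_Then_Else_ : Set → Set → Set → Set
If P Then A Else B = (P → A) × (¬ P → B)

-- Step1 C x z: from the positions x before the stage, Step 1 computes z.
-- The values of z₁ and z₂ after the first two assignments are y₁ and y₂.
Step1 : ∀ {n} → Vec ℝ (suc n) → ℝ × ℝ → ℝ × ℝ → Set
Step1 C (x₁ , x₂) (z₁ , z₂) =
  ∃[ y₁ ] ∃[ y₂ ]
    (If αₙ < x₁ Then y₁ ≃ αₙ Else y₁ ≃ x₁) ×
    (If x₂ < α₁ Then y₂ ≃ α₁ Else y₂ ≃ x₂) ×
    (If y₁ < α₁ × αₙ < y₂
       Then z₁ ≃ y₁ + δ × z₂ ≃ y₂ - δ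
       Else z₁ ≃ y₁ × z₂ ≃ y₂)
  where
  α₁ αₙ δ : ℝ
  α₁ = Vec.head C
  αₙ = Vec.last C
  δ  = ∣ x₁ - α₁ ∣ ⊓ ∣ x₂ - αₙ ∣

-- Step2 C z x: from the result z of Step 1, Step 2 may output x.
Step2 : ∀ {n} → Vec ℝ (suc n) → ℝ × ℝ → ℝ × ℝ → Set
Step2 C (z₁ , z₂) (x₁ , x₂) =
  If (α₁ ≤ z₁ × z₁ ≤ αₙ) × 3 · H D ≤ z₂ - αₙ
    Then x₁ PlacedAtMedianOf D × x₂ ≃ z₂ - 3 · H D
  Else
  If (α₁ ≤ z₂ × z₂ ≤ αₙ) × 3 · H D ≤ α₁ - z₁
    Then x₁ ≃ z₁ + 3 · H D × x₂ PlacedAtMedianOf D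
  Else
  (∃[ O₁ ] ∃[ O₂ ] IsOptimalPartition D O₁ O₂ ×
    x₁ PlacedAtMedianOf O₁ × x₂ PlacedAtMedianOf O₂)
  where
  α₁ αₙ : ℝ
  α₁ = Vec.head C
  αₙ = Vec.last C
  D : List ℝ
  D  = toList C

Stage : ∀ {n} → Vec ℝ (suc n) → ℝ × ℝ → ℝ × ℝ → Set
Stage C y x = ∃[ z ] Step1 C y z × Step2 C z x

ProducedByAlgorithm : ∀ {n T} → Instance n T → Solution T → Set
ProducedByAlgorithm I x = ∀ t → Stage (agents I t) (previous (initial I) x t) (x t)

{-# OPTIONS --safe #-}
module Submission where

-- For positions x₁ ≤ x₂ of the algorithm and o₁ ≤ o₂ of any other solution let
-- Φ = 2(|x₁ - o₁| + |x₂ - o₂|) + (x₂ - x₁); in general take the cheaper of the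
-- two matchings of x with o.  A move of o raises Φ by at most twice its length.
-- In a stage where the other solution has connection cost c, the cost of the
-- algorithm is at most 63c plus the decrease of Φ:
--   * Step 1 accounts for 4c.  It moves some facility towards its partner,
--     or past it by at most c; when both move, x₂ - x₁ pays for the other one.
--   * If H(C) ≤ c then the distances in Step 2 are O(c), except for far z's,
--     which only move by 3H(C).
--   * Otherwise o₁ serves the leftmost agent and o₂ the rightmost one.  In (a)
--     and (b) the facility moved by 3H(C) approaches its partner, which pays for
--     everything; in (c) both facilities end within 2c of their partners.
-- Summing over the stages proves the bound, as Φ is initially x₂ - x₁ and never
-- negative.

open import Defs using (If_Then_Else_)
open import Algebra.Bundles using (CommutativeMonoid)
import Algebra.Definitions.RawMonoid as RawMonoidDefs
import Algebra.Properties.CommutativeMonoid.Mult as Mult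
import Algebra.Properties.CommutativeSemigroup as CommutativeSemigroupProperties
open import Algebra.Structures using (IsAbelianGroup)
open import Data.Bool.Base using (if_then_else_)
open import Data.Empty using (⊥-elim)
open import Data.Fin.Base using (Fin; zero; suc; toℕ; fromℕ; fromℕ<; inject₁)
open import Data.Fin.Induction using (<-weakInduction)
import Data.Fin.Properties as Finₚ
open import Data.Integer.Base as ℤ using (ℤ; +_; -[1+_])
open import Data.List.Base as List using (List; []; _∷_; _++_; length)
open import Data.List.Membership.Propositional using (_∈_)
open import Data.List.Membership.Propositional.Properties using (∈-lookup)
open import Data.List.Properties using (++-identityʳ)
open import Data.List.Relation.Unary.All as All using (All; []; _∷_)
import Data.List.Relation.Unary.All.Properties as Allₚ
open import Data.List.Relation.Unary.AllPairs using (AllPairs; []; _∷_)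
open import Data.List.Relation.Unary.Any using (here; there)
open import Data.Nat.Base as ℕ using (ℕ; zero; suc; _∸_; s≤s; ⌊_/2⌋; ⌈_/2⌉)
import Data.Nat.Properties as ℕₚ
open import Data.Product.Base using (_×_; _,_; proj₁; proj₂; swap; ∃; ∃-syntax)
open import Data.Rational.Base as ℚ using (ℚ; 0ℚ; ½)
import Data.Rational.Properties as ℚₚ
open import Data.Rational.Solver using (module +-*-Solver)
open import Data.Sum.Base using (_⊎_; inj₁; inj₂; [_,_]′)
open import Data.Vec.Base as Vec using (Vec; []; _∷_; toList)
import Data.Vec.Functional as Vector
open import Data.Vec.N-ary using (N-ary; _$ⁿ_)
import Data.Vec.Properties as Vecₚ
import Data.Vec.Relation.Unary.All.Properties as VecAllₚ
open import Data.Vec.Relation.Unary.Linked using (Linked; []; [-]; _∷_)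
open import Data.Vec.Relation.Unary.Linked.Properties using (Linked⇒All)
open import Function.Base using (_∘_)
open import Level using (0ℓ)
open import Relation.Binary.PropositionalEquality
  using (_≡_; refl; sym; trans; cong; subst; subst₂)
open import Relation.Nullary.Decidable using (True; toWitness)
open import Relation.Nullary.Negation.Core using (¬_)

-- The weights in Φ come from Step 1. Let the distances have weight a and the gap x₂ - x₁ weight b.
-- When both facilities move inwards by δ, one approaches its partner but the other may recede just
-- as far, so the distance terms cancel and only the gap can pay for the movement: 2δ ≤ 2bδ. When a
-- single facility is drawn towards the agents, the gap grows, so approaching the partner has to pay
-- for the movement and for the gap: 1 + b ≤ a. The smallest choice is b = 1, a = 2.
--
-- The obstacle is constructive. The algorithm branches on comparisons of reals, which are
-- undecidable for Cauchy sequences. Everything to be concluded is an inequality, however, and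
-- inequalities are stable under double negation, so each case distinction is made in front of such
-- a goal. The geometry is developed over an abstract ordered group, where most estimates become
-- linear inequalities once bounds on the absolute values and minima are supplied.

-- Search for proofs of linear inequalities

module FourierMotzkin where

  -- A linear form required to be nonnegative, and the coefficients with which
  -- it was combined from the negated goal and the hypotheses.
  Row : Set
  Row = List ℤ × List ℕ

  private
    support : List ℕ → ℕ
    support []           = 0
    support (zero ∷ c)   = support c
    support (suc _ ∷ c)  = suc (support c)

    data Sign : Set where
      positive negative : ℕ → List ℤ → List ℕ → Sign
      vanishing         : Row → Sign

    sign : Row → Sign
    sign (+ suc a    ∷ v , c) = positive (suc a) v c
    sign (-[1+ a ]   ∷ v , c) = negative (suc a) v c
    sign (+ zero     ∷ v , c) = vanishing (v , c)
    sign ([]             , c) = vanishing ([] , c)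

    combine : ℕ → Row → ℕ → Row → Row
    combine a (v , c) b (w , d) =
      List.zipWith (λ x y → + a ℤ.* x ℤ.+ + b ℤ.* y) v w ,
      List.zipWith (λ x y → a ℕ.* x ℕ.+ b ℕ.* y) c d

    insert : ℕ → Row → List Row → List Row
    insert k r rs = if support (proj₂ r) ℕ.≤ᵇ k then r ∷ rs else rs

    -- Chernikov's rule: in the elimination number k - 1, the rows combined from
    -- more than k of the given ones are redundant.
    eliminate : ℕ → List Row → List Row
    eliminate k rows = go rows [] [] []
      where
      products : List (ℕ × Row) → List (ℕ × Row) → List Row → List Row
      products []             ns acc = acc
      products ((a , r) ∷ ps) ns acc =
        List.foldr (λ (b , s) → insert k (combine b r a s)) (products ps ns acc) ns

      go : List Row → List (ℕ × Row) → List (ℕ × Row) → List Row → List Row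
      go []       ps ns zs = products ps ns zs
      go (r ∷ rs) ps ns zs with sign r
      ... | positive a v c = go rs ((a , v , c) ∷ ps) ns zs
      ... | negative a v c = go rs ps ((a , v , c) ∷ ns) zs
      ... | vanishing z    = go rs ps ns (z ∷ zs)

    -- All inequalities are homogeneous, so a contradiction has to involve the only strict one, the
    -- negated goal. Its coefficient comes first; hence the search for a row in which that
    -- coefficient is positive.
    pick : List Row → List ℕ
    pick []                    = []
    pick ((_ , suc k ∷ c) ∷ _) = suc k ∷ c
    pick (_ ∷ rows)            = pick rows

    run : ℕ → ℕ → List Row → List Row
    run zero    k rows = rows
    run (suc n) k rows = run n (suc k) (eliminate k rows)

    units : ℕ → List (List ℤ) → List Row
    units m []       = []
    units m (v ∷ vs) =
      (v , List.replicate m 0 ++ 1 ∷ List.replicate (length vs) 0) ∷ units (suc m) vs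

  -- Nothing is proved about this search. `Certified` checks the answer, and a useless answer only
  -- makes that check fail.
  multipliers : ℕ → List (List ℤ) → List ℕ
  multipliers n rows = pick (run n 2 (units 0 rows))

-- Ordered groups with undecidable order, and their linear solver

record IsOrderedGroup
  {A : Set} (_≤_ : A → A → Set)
  (_+_ _-_ : A → A → A) (0# : A) (-_ ∣_∣ : A → A) (_⊓_ : A → A → A) : Set where
  field
    ≤-refl         : ∀ {x} → x ≤ x
    ≤-trans        : ∀ {x y z} → x ≤ y → y ≤ z → x ≤ z
    ≤-stable       : ∀ {x y} → ¬ ¬ (x ≤ y) → x ≤ y
    ≤-total        : ∀ x y → ¬ ¬ (x ≤ y ⊎ y ≤ x)
    isAbelianGroup : IsAbelianGroup (λ x y → x ≤ y × y ≤ x) _+_ 0# (-_)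
    x-y≃x+-y       : ∀ x y → (x - y) ≤ (x + (- y)) × (x + (- y)) ≤ (x - y)
    +-monoʳ-≤      : ∀ x {y z} → y ≤ z → (x + y) ≤ (x + z)
    x≤∣x∣          : ∀ x → x ≤ ∣ x ∣
    -x≤∣x∣         : ∀ x → (- x) ≤ ∣ x ∣
    ∣x∣≤y          : ∀ {x y} → x ≤ y → (- x) ≤ y → ∣ x ∣ ≤ y
    x⊓y≤x          : ∀ x y → (x ⊓ y) ≤ x
    x⊓y≤y          : ∀ x y → (x ⊓ y) ≤ y
    ⊓-glb          : ∀ {x y z} → z ≤ x → z ≤ y → z ≤ (x ⊓ y)

module OrderedGroup
  {A : Set} {_≤_ : A → A → Set}
  {_+_ _-_ : A → A → A} {0# : A} { -_ ∣_∣ : A → A} {_⊓_ : A → A → A}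
  (isOrderedGroup : IsOrderedGroup _≤_ _+_ _-_ 0# (-_) ∣_∣ _⊓_) where

  infix  4 _≃_
  infixl 7 _·_

  open IsOrderedGroup isOrderedGroup public
  open IsAbelianGroup isAbelianGroup public
    using (assoc; comm; identityˡ; identityʳ; inverseˡ; inverseʳ)
    renaming (refl to ≃-refl; sym to ≃-sym; trans to ≃-trans;
              ∙-cong to +-cong; ∙-congˡ to +-congˡ; ∙-congʳ to +-congʳ)

  _≃_ : A → A → Set
  x ≃ y = x ≤ y × y ≤ x

  +-0-commutativeMonoid : CommutativeMonoid 0ℓ 0ℓ
  +-0-commutativeMonoid = record
    { isCommutativeMonoid = IsAbelianGroup.isCommutativeMonoid isAbelianGroup }

  open Mult +-0-commutativeMonoid using (×-homo-+; ×-distrib-+; ×-assocˡ; ×-congʳ)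
  open CommutativeSemigroupProperties
    (CommutativeMonoid.commutativeSemigroup +-0-commutativeMonoid) using (interchange)

  _·_ : ℕ → A → A
  _·_ = RawMonoidDefs._×_ (CommutativeMonoid.rawMonoid +-0-commutativeMonoid)

  +-mono-≤ : ∀ {x y u v} → x ≤ y → u ≤ v → (x + u) ≤ (y + v)
  +-mono-≤ {x} {y} {u} {v} x≤y u≤v =
    ≤-trans (+-monoʳ-≤ x u≤v)
      (≤-trans (proj₁ (comm x v)) (≤-trans (+-monoʳ-≤ v x≤y) (proj₁ (comm v y))))

  +-cancelˡ-≤ : ∀ z {x y} → (z + x) ≤ (z + y) → x ≤ y
  +-cancelˡ-≤ z {x} {y} le =
    ≤-trans (proj₂ (undo x)) (≤-trans (+-monoʳ-≤ (- z) le) (proj₁ (undo y)))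
    where
    undo : ∀ w → ((- z) + (z + w)) ≃ w
    undo w = ≃-trans (≃-sym (assoc (- z) z w))
      (≃-trans (+-congʳ (inverseˡ z)) (identityˡ w))

  ·-mono-≤ : ∀ n {x y} → x ≤ y → (n · x) ≤ (n · y)
  ·-mono-≤ zero    le = ≤-refl
  ·-mono-≤ (suc n) le = +-mono-≤ le (·-mono-≤ n le)

  -- Order comparisons are decided only up to double negation, which suffices
  -- for a stable goal.  Conclusions that need such case distinctions are
  -- therefore stated in continuation-passing style, with a goal u ≤ v.
  ≤-cases : ∀ x y {u v} → (x ≤ y → u ≤ v) → (y ≤ x → u ≤ v) → u ≤ v
  ≤-cases x y f g = ≤-stable λ ¬le → ≤-total x y [ ¬le ∘ f , ¬le ∘ g ]′

  -- The group has no division. If y ≤ x, then n·y + x ≤ n·x + x ≤ n·y + y, and n·y cancels.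
  ·-cancel-≤ : ∀ n {x y} → (suc n · x) ≤ (suc n · y) → x ≤ y
  ·-cancel-≤ n {x} {y} le = ≤-cases x y (λ x≤y → x≤y) λ y≤x →
    +-cancelˡ-≤ (n · y) (≤-trans
      (+-mono-≤ (·-mono-≤ n y≤x) (≤-refl {x}))
      (≤-trans (proj₁ (comm (n · x) x)) (≤-trans le (proj₁ (comm y (n · y))))))

  -- A solver for linear inequalities

  infixl 7 _:·_
  infixl 6 _:+_ _:-_
  infix  5 _:≤_
  infixr 4 _:⇒_

  data Expr (n : ℕ) : Set where
    var       : Fin n → Expr n
    _:+_ _:-_ : Expr n → Expr n → Expr n
    _:·_      : ℕ → Expr n → Expr n
    :0        : Expr n

  data Sequent (n : ℕ) : Set where
    _:≤_ : Expr n → Expr n → Sequent n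
    _:⇒_ : Sequent n → Sequent n → Sequent n

  ⟦_⟧ : ∀ {n} → Expr n → Vec A n → A
  ⟦ var i ⟧  ρ = Vec.lookup ρ i
  ⟦ e :+ f ⟧ ρ = ⟦ e ⟧ ρ + ⟦ f ⟧ ρ
  ⟦ e :- f ⟧ ρ = ⟦ e ⟧ ρ - ⟦ f ⟧ ρ
  ⟦ k :· e ⟧ ρ = k · ⟦ e ⟧ ρ
  ⟦ :0 ⟧     ρ = 0#

  Holds : ∀ {n} → Sequent n → Vec A n → Set
  Holds (e :≤ f) ρ = ⟦ e ⟧ ρ ≤ ⟦ f ⟧ ρ
  Holds (s :⇒ t) ρ = Holds s ρ → Holds t ρ

  private
    Form : ℕ → Set
    Form = Vec ℕ

    0ᶠ : ∀ {n} → Form n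
    0ᶠ = Vec.replicate _ 0

    unit : ∀ {n} → Fin n → Form n
    unit zero    = 1 ∷ 0ᶠ
    unit (suc i) = 0 ∷ unit i

    _+ᶠ_ : ∀ {n} → Form n → Form n → Form n
    _+ᶠ_ = Vec.zipWith ℕ._+_

    _·ᶠ_ : ∀ {n} → ℕ → Form n → Form n
    k ·ᶠ v = Vec.map (k ℕ.*_) v

    eval : ∀ {n} → Form n → Vec A n → A
    eval []      []      = 0#
    eval (k ∷ v) (x ∷ ρ) = (k · x) + eval v ρ

    eval-0 : ∀ {n} (ρ : Vec A n) → eval 0ᶠ ρ ≃ 0#
    eval-0 []      = ≃-refl
    eval-0 (x ∷ ρ) = ≃-trans (+-congˡ (eval-0 ρ)) (identityˡ 0#)

    eval-unit : ∀ {n} (i : Fin n) ρ → eval (unit i) ρ ≃ Vec.lookup ρ i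
    eval-unit zero    (x ∷ ρ) =
      ≃-trans (+-cong (identityʳ x) (eval-0 ρ)) (identityʳ x)
    eval-unit (suc i) (x ∷ ρ) = ≃-trans (identityˡ _) (eval-unit i ρ)

    eval-+ : ∀ {n} (v w : Form n) ρ → eval (v +ᶠ w) ρ ≃ (eval v ρ + eval w ρ)
    eval-+ []      []      []      = ≃-sym (identityˡ 0#)
    eval-+ (k ∷ v) (l ∷ w) (x ∷ ρ) =
      ≃-trans (+-cong (×-homo-+ x k l) (eval-+ v w ρ)) (interchange _ _ _ _)

    eval-· : ∀ {n} k (v : Form n) ρ → eval (k ·ᶠ v) ρ ≃ (k · eval v ρ)
    eval-· k []      []      = ≃-sym (k·0 k)
      where
      k·0 : ∀ k → (k · 0#) ≃ 0#
      k·0 zero    = ≃-refl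
      k·0 (suc k) = ≃-trans (identityˡ _) (k·0 k)
    eval-· k (l ∷ v) (x ∷ ρ) = ≃-trans
      (+-cong (≃-sym (×-assocˡ x k l)) (eval-· k v ρ)) (≃-sym (×-distrib-+ _ _ k))

    pos neg : ∀ {n} → Expr n → Form n
    pos (var i)  = unit i
    pos (e :+ f) = pos e +ᶠ pos f
    pos (e :- f) = pos e +ᶠ neg f
    pos (k :· e) = k ·ᶠ pos e
    pos :0       = 0ᶠ
    neg (var i)  = 0ᶠ
    neg (e :+ f) = neg e +ᶠ neg f
    neg (e :- f) = neg e +ᶠ pos f
    neg (k :· e) = k ·ᶠ neg e
    neg :0       = 0ᶠ

    -- Moving the negative part to the left avoids subtraction.
    normal : ∀ {n} (e : Expr n) ρ → (⟦ e ⟧ ρ + eval (neg e) ρ) ≃ eval (pos e) ρ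
    normal (var i) ρ = ≃-trans (+-congˡ (eval-0 ρ))
      (≃-trans (identityʳ _) (≃-sym (eval-unit i ρ)))
    normal (e :+ f) ρ = ≃-trans (+-congˡ (eval-+ (neg e) (neg f) ρ))
      (≃-trans (interchange _ _ _ _)
      (≃-trans (+-cong (normal e ρ) (normal f ρ)) (≃-sym (eval-+ (pos e) (pos f) ρ))))
    normal (e :- f) ρ = ≃-trans (+-congʳ (x-y≃x+-y _ _))
      (≃-trans (+-congˡ (eval-+ (neg e) (pos f) ρ))
      (≃-trans (interchange _ _ _ _)
      (≃-trans (+-cong (normal e ρ) cancel) (≃-sym (eval-+ (pos e) (neg f) ρ)))))
      where
      cancel : ((- ⟦ f ⟧ ρ) + eval (pos f) ρ) ≃ eval (neg f) ρ
      cancel = ≃-trans (+-congˡ (≃-sym (normal f ρ)))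
        (≃-trans (≃-sym (assoc _ _ _))
        (≃-trans (+-congʳ (inverseˡ _)) (identityˡ _)))
    normal (k :· e) ρ = ≃-trans (+-congˡ (eval-· k (neg e) ρ))
      (≃-trans (≃-sym (×-distrib-+ _ _ k))
      (≃-trans (×-congʳ k (normal e ρ)) (≃-sym (eval-· k (pos e) ρ))))
    normal :0 ρ = ≃-trans (+-congˡ (eval-0 ρ))
      (≃-trans (identityˡ _) (≃-sym (eval-0 ρ)))

    left right : ∀ {n} → Expr n → Expr n → Form n
    left  e f = pos e +ᶠ neg f
    right e f = pos f +ᶠ neg e

    ≃⇒≤≤ : ∀ {a b c d} → a ≃ c → b ≃ d → a ≤ b → c ≤ d
    ≃⇒≤≤ (_ , c≤a) (b≤d , _) a≤b = ≤-trans c≤a (≤-trans a≤b b≤d)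

    left-eval : ∀ {n} (e f : Expr n) ρ →
      eval (left e f) ρ ≃ ((eval (neg e) ρ + eval (neg f) ρ) + ⟦ e ⟧ ρ)
    left-eval e f ρ = ≃-trans (eval-+ (pos e) (neg f) ρ)
      (≃-trans (+-congʳ (≃-sym (normal e ρ)))
      (≃-trans (assoc _ _ _) (comm _ _)))

    right-eval : ∀ {n} (e f : Expr n) ρ →
      eval (right e f) ρ ≃ ((eval (neg e) ρ + eval (neg f) ρ) + ⟦ f ⟧ ρ)
    right-eval e f ρ = ≃-trans (left-eval f e ρ) (+-congʳ (comm _ _))

    to : ∀ {n} (e f : Expr n) ρ → ⟦ e ⟧ ρ ≤ ⟦ f ⟧ ρ → eval (left e f) ρ ≤ eval (right e f) ρ
    to e f ρ le = ≃⇒≤≤ (≃-sym (left-eval e f ρ)) (≃-sym (right-eval e f ρ)) (+-monoʳ-≤ _ le)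

    from : ∀ {n} (e f : Expr n) ρ → eval (left e f) ρ ≤ eval (right e f) ρ → ⟦ e ⟧ ρ ≤ ⟦ f ⟧ ρ
    from e f ρ le = +-cancelˡ-≤ _ (≃⇒≤≤ (left-eval e f ρ) (right-eval e f ρ) le)

    -- Certified k cs s a b: s follows from a ≤ b, by multiplying the
    -- hypotheses of s by cs and its goal by suc k.
    Certified : ∀ {n} → ℕ → List ℕ → Sequent n → Form n → Form n → Set
    Certified k cs (e :≤ f) a b =
      True (Vecₚ.≡-dec ℕₚ._≟_ (a +ᶠ (suc k ·ᶠ right e f)) (b +ᶠ (suc k ·ᶠ left e f)))
    Certified k (c ∷ cs) ((e :≤ f) :⇒ t) a b =
      Certified k cs t (a +ᶠ (c ·ᶠ left e f)) (b +ᶠ (c ·ᶠ right e f))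
    Certified k cs (s :⇒ t) a b = Certified k [] t a b

    sound : ∀ {n} k cs (s : Sequent n) a b ρ →
      Certified k cs s a b → eval a ρ ≤ eval b ρ → Holds s ρ
    sound k cs (e :≤ f) a b ρ eq a≤b = from e f ρ (·-cancel-≤ k
      (≃⇒≤≤ (eval-· (suc k) (left e f) ρ) (eval-· (suc k) (right e f) ρ)
      (+-cancelˡ-≤ (eval b ρ)
      (≤-trans (proj₂ (eval-+ b (suc k ·ᶠ left e f) ρ))
      (subst (λ v → eval v ρ ≤ _) (toWitness eq)
      (≤-trans (proj₁ (eval-+ a (suc k ·ᶠ right e f) ρ))
      (+-mono-≤ a≤b ≤-refl)))))))
    sound k (c ∷ cs) ((e :≤ f) :⇒ t) a b ρ cert a≤b le =
      sound k cs t (a +ᶠ (c ·ᶠ left e f)) (b +ᶠ (c ·ᶠ right e f)) ρ cert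
      (≃⇒≤≤ (≃-sym (eval-+ a _ ρ)) (≃-sym (eval-+ b _ ρ))
      (+-mono-≤ a≤b
      (≃⇒≤≤ (≃-sym (eval-· c (left e f) ρ)) (≃-sym (eval-· c (right e f) ρ))
      (·-mono-≤ c (to e f ρ le)))))
    sound k []       ((_ :≤ _) :⇒ t) a b ρ cert a≤b _ = sound k [] t a b ρ cert a≤b
    sound k []       ((_ :⇒ _) :⇒ t) a b ρ cert a≤b _ = sound k [] t a b ρ cert a≤b
    sound k (_ ∷ _)  ((_ :⇒ _) :⇒ t) a b ρ cert a≤b _ = sound k [] t a b ρ cert a≤b

    difference : ∀ {n} → Form n → Form n → List ℤ
    difference v w = Vec.toList (Vec.zipWith (λ k l → k ℤ.⊖ l) v w)

    rows : ∀ {n} → Sequent n → List (List ℤ) → List (List ℤ)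
    rows (e :≤ f)        acc = difference (left e f) (right e f) ∷ List.reverse acc
    rows ((e :≤ f) :⇒ t) acc = rows t (difference (right e f) (left e f) ∷ acc)
    rows (_ :⇒ t)        acc = rows t acc

    certificate : ∀ {n} → Sequent n → ℕ × List ℕ
    certificate {n} s with FourierMotzkin.multipliers n (rows s [])
    ... | suc k ∷ cs = k , cs
    ... | _          = 0 , []

  -- For closed `n` and `f` the certificate is found and checked by normalisation: the hidden
  -- argument becomes the unit type exactly if the multipliers are right, whatever `ρ` is.
  prove : ∀ n (f : N-ary n (Expr n) (Sequent n)) (ρ : Vec A n) →
    let s      = f $ⁿ Vec.map var (Vec.allFin n)
        k , cs = certificate s
    in {Certified k cs s 0ᶠ 0ᶠ} → Holds s ρ
  prove n f ρ {cert} =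
    sound _ (proj₂ (certificate s)) s 0ᶠ 0ᶠ ρ cert ≤-refl
    where
    s : Sequent n
    s = f $ⁿ Vec.map var (Vec.allFin n)

-- Connection costs: medians and division between two facilities

module Facilities
  {A : Set} {_≤_ : A → A → Set}
  {_+_ _-_ : A → A → A} {0# : A} { -_ ∣_∣ : A → A} {_⊓_ : A → A → A}
  (isOrderedGroup : IsOrderedGroup _≤_ _+_ _-_ 0# (-_) ∣_∣ _⊓_) where

  open OrderedGroup isOrderedGroup

  sum : List A → A
  sum = List.foldr _+_ 0#

  cost : List A → A → A
  cost D p = sum (List.map (λ β → ∣ β - p ∣) D)

  cost₂ : List A → A → A → A
  cost₂ D p q = sum (List.map (λ β → ∣ β - p ∣ ⊓ ∣ β - q ∣) D)

  -‿congʳ : ∀ {x y z} → x ≃ y → (x - z) ≃ (y - z)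
  -‿congʳ {x} {y} {z} (le , ge) =
    prove 3 (λ x y z → x :≤ y :⇒ x :- z :≤ y :- z) (x ∷ y ∷ z ∷ []) le ,
    prove 3 (λ x y z → x :≤ y :⇒ x :- z :≤ y :- z) (y ∷ x ∷ z ∷ []) ge

  private
    y-x≃-[x-y] : ∀ x y → (y - x) ≃ (- (x - y))
    y-x≃-[x-y] x y =
      +-cancelˡ-≤ (x - y) (≤-trans
        (prove 2 (λ x y → (x :- y) :+ (y :- x) :≤ :0) (x ∷ y ∷ []))
        (proj₂ (inverseʳ (x - y)))) ,
      +-cancelˡ-≤ (x - y) (≤-trans (proj₁ (inverseʳ (x - y)))
        (prove 2 (λ x y → :0 :≤ (x :- y) :+ (y :- x)) (x ∷ y ∷ [])))

  ∣x-y∣≤z : ∀ {x y z} → (x - y) ≤ z → (y - x) ≤ z → ∣ x - y ∣ ≤ z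
  ∣x-y∣≤z {x} {y} le ge = ∣x∣≤y le (≤-trans (proj₂ (y-x≃-[x-y] x y)) ge)

  x-x≤0 : ∀ x → (x - x) ≤ 0#
  x-x≤0 x = prove 1 (λ x → x :- x :≤ :0) (x ∷ [])

  x-y≤∣x-y∣ : ∀ x y → (x - y) ≤ ∣ x - y ∣
  x-y≤∣x-y∣ x y = x≤∣x∣ (x - y)

  y-x≤∣x-y∣ : ∀ x y → (y - x) ≤ ∣ x - y ∣
  y-x≤∣x-y∣ x y = ≤-trans (proj₁ (y-x≃-[x-y] x y)) (-x≤∣x∣ (x - y))

  0≤∣x-y∣ : ∀ x y → 0# ≤ ∣ x - y ∣
  0≤∣x-y∣ x y = prove 3 (λ x y d → x :- y :≤ d :⇒ y :- x :≤ d :⇒ :0 :≤ d)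
    (x ∷ y ∷ ∣ x - y ∣ ∷ []) (x-y≤∣x-y∣ x y) (y-x≤∣x-y∣ x y)

  cost≥0 : ∀ D p → 0# ≤ cost D p
  cost≥0 []      p = ≤-refl
  cost≥0 (β ∷ D) p = ≤-trans (proj₂ (identityˡ 0#))
    (+-mono-≤ (0≤∣x-y∣ β p) (cost≥0 D p))

  cost-∈ : ∀ {D β} p → β ∈ D → ∣ β - p ∣ ≤ cost D p
  cost-∈ {β ∷ D} p (here refl) = ≤-trans (proj₂ (identityʳ _))
    (+-monoʳ-≤ _ (cost≥0 D p))
  cost-∈ {γ ∷ D} p (there β∈D) = ≤-trans (cost-∈ p β∈D)
    (≤-trans (proj₂ (identityˡ _)) (+-mono-≤ (0≤∣x-y∣ γ p) ≤-refl))

  private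
    Σ-shift : ∀ {s} (f g : A → A) {D} →
      All (λ β → f β ≤ (g β + s)) D →
      sum (List.map f D) ≤ (sum (List.map g D) + (length D · s))
    Σ-shift f g [] = proj₂ (identityʳ 0#)
    Σ-shift {s} f g {β ∷ D} (le ∷ les) =
      prove 6 (λ a b c d s l → a :≤ b :+ s :⇒ c :≤ d :+ l :⇒ a :+ c :≤ (b :+ d) :+ (s :+ l))
        (f β ∷ g β ∷ sum (List.map f D) ∷ sum (List.map g D) ∷ s ∷ (length D · s) ∷ [])
        le (Σ-shift f g les)

    nearer : ∀ {β x p} → β ≤ x → x ≤ p → (∣ β - x ∣ + (p - x)) ≤ ∣ β - p ∣
    nearer {β} {x} {p} β≤x x≤p = ≤-trans
      (+-mono-≤ (∣x-y∣≤z
        (prove 2 (λ β x → β :≤ x :⇒ β :- x :≤ x :- β) (β ∷ x ∷ []) β≤x)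
        ≤-refl) ≤-refl)
      (prove 4 (λ β x p d → p :- β :≤ d :⇒ (x :- β) :+ (p :- x) :≤ d)
        (β ∷ x ∷ p ∷ ∣ β - p ∣ ∷ []) (y-x≤∣x-y∣ β p))

    nearer′ : ∀ {β x p} → x ≤ β → p ≤ x → (∣ β - x ∣ + (x - p)) ≤ ∣ β - p ∣
    nearer′ {β} {x} {p} x≤β p≤x = ≤-trans
      (+-mono-≤ (∣x-y∣≤z ≤-refl
        (prove 2 (λ β x → x :≤ β :⇒ x :- β :≤ β :- x) (β ∷ x ∷ []) x≤β)) ≤-refl)
      (prove 4 (λ β x p d → β :- p :≤ d :⇒ (β :- x) :+ (x :- p) :≤ d)
        (β ∷ x ∷ p ∷ ∣ β - p ∣ ∷ []) (x-y≤∣x-y∣ β p))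

    farther : ∀ {x p} β → x ≤ p → ∣ β - x ∣ ≤ (∣ β - p ∣ + (p - x))
    farther {x} {p} β x≤p = ∣x-y∣≤z
      (prove 4 (λ β x p d → β :- p :≤ d :⇒ β :- x :≤ d :+ (p :- x))
        (β ∷ x ∷ p ∷ ∣ β - p ∣ ∷ []) (x-y≤∣x-y∣ β p))
      (prove 4 (λ β x p d → p :- β :≤ d :⇒ x :≤ p :⇒ x :- β :≤ d :+ (p :- x))
        (β ∷ x ∷ p ∷ ∣ β - p ∣ ∷ []) (y-x≤∣x-y∣ β p) x≤p)

    farther′ : ∀ {x p} β → p ≤ x → ∣ β - x ∣ ≤ (∣ β - p ∣ + (x - p))
    farther′ {x} {p} β p≤x = ∣x-y∣≤z
      (prove 4 (λ β x p d → β :- p :≤ d :⇒ p :≤ x :⇒ β :- x :≤ d :+ (x :- p))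
        (β ∷ x ∷ p ∷ ∣ β - p ∣ ∷ []) (x-y≤∣x-y∣ β p) p≤x)
      (prove 4 (λ β x p d → p :- β :≤ d :⇒ x :- β :≤ d :+ (x :- p))
        (β ∷ x ∷ p ∷ ∣ β - p ∣ ∷ []) (y-x≤∣x-y∣ β p))

    merge : ∀ {a b c d s k l} → (a + s) ≤ b → (c + k) ≤ (d + l) →
      ((a + c) + (s + k)) ≤ ((b + d) + l)
    merge {a} {b} {c} {d} {s} {k} {l} = prove 7
      (λ a b c d s k l → a :+ s :≤ b :⇒ c :+ k :≤ d :+ l :⇒
        (a :+ c) :+ (s :+ k) :≤ (b :+ d) :+ l)
      (a ∷ b ∷ c ∷ d ∷ s ∷ k ∷ l ∷ [])

  -- The first `suc i` positions are not to the right of `x`, so each of them is farther from `p` by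
  -- p - x; any other position is nearer to `p` by at most p - x. Both amounts are added, on
  -- opposite sides, because multiples are taken by natural numbers.
  cost-moveʳ : ∀ {D x p} → AllPairs _≤_ D → (i : Fin (length D)) →
    List.lookup D i ≤ x → x ≤ p →
    (cost D x + (suc (toℕ i) · (p - x))) ≤ (cost D p + ((length D ∸ suc (toℕ i)) · (p - x)))
  cost-moveʳ {β ∷ D} {x} {p} _ zero β≤x x≤p = merge (nearer β≤x x≤p)
    (≤-trans (proj₁ (identityʳ _)) (Σ-shift _ _ {D} (All.tabulate λ {γ} _ → farther γ x≤p)))
  cost-moveʳ {β ∷ D} (β≤ ∷ sorted) (suc i) Dᵢ≤x x≤p = merge
    (nearer (≤-trans (All.lookup β≤ (∈-lookup i)) Dᵢ≤x) x≤p)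
    (cost-moveʳ sorted i Dᵢ≤x x≤p)

  cost-moveˡ : ∀ {D x p} → AllPairs _≤_ D → (j : Fin (length D)) →
    x ≤ List.lookup D j → p ≤ x →
    (cost D x + ((length D ∸ toℕ j) · (x - p))) ≤ (cost D p + (toℕ j · (x - p)))
  cost-moveˡ {β ∷ D} {x} {p} (β≤ ∷ _) zero x≤β p≤x = merge (nearer′ x≤β p≤x) (go D β≤)
    where
    go : ∀ D → All (β ≤_) D → (cost D x + (length D · (x - p))) ≤ (cost D p + 0#)
    go []      []          = ≤-refl
    go (γ ∷ D) (β≤γ ∷ β≤D) = merge (nearer′ (≤-trans x≤β β≤γ) p≤x) (go D β≤D)
  cost-moveˡ {β ∷ D} {x} {p} (_ ∷ sorted) (suc j) x≤Dⱼ p≤x =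
    prove 7 (λ a b c d s k l → a :≤ b :+ s :⇒ c :+ k :≤ d :+ l :⇒
        (a :+ c) :+ k :≤ (b :+ d) :+ (s :+ l))
      (∣ β - x ∣ ∷ ∣ β - p ∣ ∷ cost D x ∷ cost D p ∷ (x - p) ∷
        ((length D ∸ toℕ j) · (x - p)) ∷ (toℕ j · (x - p)) ∷ [])
      (farther′ β p≤x) (cost-moveˡ sorted j x≤Dⱼ p≤x)

  ·-monoˡ-≤ : ∀ {m n s} → m ℕ.≤ n → 0# ≤ s → (m · s) ≤ (n · s)
  ·-monoˡ-≤ {n = zero}  ℕ.z≤n      0≤s = ≤-refl
  ·-monoˡ-≤ {n = suc n} ℕ.z≤n      0≤s = ≤-trans (proj₂ (identityˡ 0#))
    (+-mono-≤ 0≤s (·-monoˡ-≤ (ℕ.z≤n {n}) 0≤s))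
  ·-monoˡ-≤ (ℕ.s≤s m≤n) 0≤s = +-monoʳ-≤ _ (·-monoˡ-≤ m≤n 0≤s)

  -- The conditions on `i` and `j` say that at least half of the positions are on either side of
  -- `x`. So in whichever direction the facility leaves `x`, the losses outweigh the gains.
  median-minimal : ∀ {D x} → AllPairs _≤_ D → (i j : Fin (length D)) →
    length D ∸ suc (toℕ i) ℕ.≤ suc (toℕ i) → toℕ j ℕ.≤ length D ∸ toℕ j →
    List.lookup D i ≤ x → x ≤ List.lookup D j → ∀ p → cost D x ≤ cost D p
  median-minimal {D} {x} sorted i j i-large j-small Dᵢ≤x x≤Dⱼ p = ≤-cases x p
    (λ x≤p → conclude (cost-moveʳ sorted i Dᵢ≤x x≤p) (·-monoˡ-≤ i-large (0≤d x≤p)))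
    (λ p≤x → conclude (cost-moveˡ sorted j x≤Dⱼ p≤x) (·-monoˡ-≤ j-small (0≤d p≤x)))
    where
    0≤d : ∀ {x p} → x ≤ p → 0# ≤ (p - x)
    0≤d {x} {p} = prove 2 (λ x p → x :≤ p :⇒ :0 :≤ p :- x) (x ∷ p ∷ [])
    conclude : ∀ {a b k l} → (a + k) ≤ (b + l) → l ≤ k → a ≤ b
    conclude {a} {b} {k} {l} = prove 4 (λ a b k l → a :+ k :≤ b :+ l :⇒ l :≤ k :⇒ a :≤ b)
      (a ∷ b ∷ k ∷ l ∷ [])

  -- The cut is at the midpoint of `p` and `q`, tested as β + β against p + q for want of halves.
  -- Beyond the first agent on the right of it, all agents are nearer to `q`, since the list is
  -- sorted.
  cost₂-split : ∀ {C p q u v} → AllPairs _≤_ C → p ≤ q →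
    (∀ P Q → P ++ Q ≡ C → (cost P p + cost Q q) ≤ cost₂ C p q → u ≤ v) → u ≤ v
  cost₂-split {[]} _ _ k = k [] [] refl (proj₁ (identityʳ 0#))
  cost₂-split {β ∷ C} {p} {q} (β≤ ∷ sorted) p≤q k = ≤-cases (p + q) (β + β)
    (λ right → k [] (β ∷ C) refl (≤-trans (proj₁ (identityˡ _))
      (nearest-q (β ∷ C) (right ∷ All.map (λ β≤γ →
        ≤-trans right (+-mono-≤ β≤γ β≤γ)) β≤))))
    (λ left → cost₂-split sorted p≤q λ P Q eq le → k (β ∷ P) Q (cong (β ∷_) eq)
      (≤-trans (proj₁ (assoc _ _ _)) (+-mono-≤ (nearest-p left) le)))
    where
    nearest-p : (β + β) ≤ (p + q) → ∣ β - p ∣ ≤ (∣ β - p ∣ ⊓ ∣ β - q ∣)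
    nearest-p left = ⊓-glb ≤-refl (∣x-y∣≤z
      (prove 4 (λ β p q d → q :- β :≤ d :⇒ β :+ β :≤ p :+ q :⇒ β :- p :≤ d)
        (β ∷ p ∷ q ∷ ∣ β - q ∣ ∷ []) (y-x≤∣x-y∣ β q) left)
      (prove 4 (λ β p q d → q :- β :≤ d :⇒ p :≤ q :⇒ p :- β :≤ d)
        (β ∷ p ∷ q ∷ ∣ β - q ∣ ∷ []) (y-x≤∣x-y∣ β q) p≤q))

    nearest-q : ∀ D → All (λ γ → (p + q) ≤ (γ + γ)) D → cost D q ≤ cost₂ D p q
    nearest-q []      []       = ≤-refl
    nearest-q (γ ∷ D) (r ∷ rs) = +-mono-≤ (⊓-glb (∣x-y∣≤z
      (prove 4 (λ γ p q d → γ :- p :≤ d :⇒ p :≤ q :⇒ γ :- q :≤ d)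
        (γ ∷ p ∷ q ∷ ∣ γ - p ∣ ∷ []) (x-y≤∣x-y∣ γ p) p≤q)
      (prove 4 (λ γ p q d → γ :- p :≤ d :⇒ p :+ q :≤ γ :+ γ :⇒ q :- γ :≤ d)
        (γ ∷ p ∷ q ∷ ∣ γ - p ∣ ∷ []) (x-y≤∣x-y∣ γ p) r))
      ≤-refl) (nearest-q D rs)

  cost₂≥0 : ∀ C p q → 0# ≤ cost₂ C p q
  cost₂≥0 []      p q = ≤-refl
  cost₂≥0 (β ∷ C) p q = ≤-trans (proj₂ (identityˡ 0#))
    (+-mono-≤ (⊓-glb (0≤∣x-y∣ β p) (0≤∣x-y∣ β q)) (cost₂≥0 C p q))

  cost₂≤cost₁ : ∀ C p q → cost₂ C p q ≤ cost C p
  cost₂≤cost₁ []      p q = ≤-refl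
  cost₂≤cost₁ (β ∷ C) p q = +-mono-≤ (x⊓y≤x _ _) (cost₂≤cost₁ C p q)

  cost₂-comm : ∀ C p q → cost₂ C p q ≤ cost₂ C q p
  cost₂-comm []      p q = ≤-refl
  cost₂-comm (β ∷ C) p q = +-mono-≤ (⊓-glb (x⊓y≤y _ _) (x⊓y≤x _ _)) (cost₂-comm C p q)

  cost₂-++ : ∀ P Q p q → cost₂ (P ++ Q) p q ≤ (cost P p + cost Q q)
  cost₂-++ []      Q p q = ≤-trans (cost₂-comm Q p q)
    (≤-trans (cost₂≤cost₁ Q q p) (proj₂ (identityˡ _)))
  cost₂-++ (β ∷ P) Q p q = ≤-trans (+-mono-≤ (x⊓y≤x _ _) (cost₂-++ P Q p q))
    (proj₂ (assoc _ _ _))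

  -- An additional facility at `β` serves the agent there for free and makes no other agent pay
  -- more.
  cost₂-saves : ∀ {C β} q → β ∈ C → (∣ β - q ∣ + cost₂ C β q) ≤ cost C q
  cost₂-saves {β ∷ C} q (here refl) = +-monoʳ-≤ _ (≤-trans
    (+-mono-≤ (≤-trans (x⊓y≤x _ _) (∣x-y∣≤z (x-x≤0 β) (x-x≤0 β)))
      (≤-trans (cost₂-comm C β q) (cost₂≤cost₁ C q β)))
    (proj₁ (identityˡ _)))
  cost₂-saves {γ ∷ C} {β} q (there β∈C) =
    prove 5 (λ a m g c d → a :+ c :≤ d :⇒ m :≤ g :⇒ a :+ (m :+ c) :≤ g :+ d)
      (∣ β - q ∣ ∷ (∣ γ - β ∣ ⊓ ∣ γ - q ∣) ∷ ∣ γ - q ∣ ∷ cost₂ C β q ∷ cost C q ∷ [])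
      (cost₂-saves q β∈C) (x⊓y≤y _ _)

  lastOf : A → List A → A
  lastOf α []      = α
  lastOf α (β ∷ D) = lastOf β D

  lastOf-∈ : ∀ α D → lastOf α D ∈ α ∷ D
  lastOf-∈ α []      = here refl
  lastOf-∈ α (β ∷ D) = there (lastOf-∈ β D)

  lastOf-++ : ∀ α D β E → lastOf α (D ++ β ∷ E) ≡ lastOf β E
  lastOf-++ α []      β E = refl
  lastOf-++ α (γ ∷ D) β E = lastOf-++ γ D β E

  ≤lastOf : ∀ {α D} → AllPairs _≤_ (α ∷ D) → ∀ {β} → β ∈ α ∷ D → β ≤ lastOf α D
  ≤lastOf {D = []}    _                (here refl)  = ≤-refl
  ≤lastOf {D = γ ∷ D} ((le ∷ _) ∷ srt) (here refl)  = ≤-trans le (≤lastOf srt (here refl))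
  ≤lastOf {D = γ ∷ D} (_ ∷ srt)        (there β∈D)  = ≤lastOf srt β∈D

  head≤ : ∀ {α D} → AllPairs _≤_ (α ∷ D) → ∀ {β} → β ∈ α ∷ D → α ≤ β
  head≤ _         (here refl) = ≤-refl
  head≤ (le ∷ _)  (there β∈D) = All.lookup le β∈D

  lookup-mono : ∀ {D} → AllPairs _≤_ D → (i j : Fin (length D)) → toℕ i ℕ.≤ toℕ j →
    List.lookup D i ≤ List.lookup D j
  lookup-mono {β ∷ D} _            zero    zero    _           = ≤-refl
  lookup-mono {β ∷ D} (β≤ ∷ _)     zero    (suc j) _           = All.lookup β≤ (∈-lookup j)
  lookup-mono {β ∷ D} (_ ∷ sorted) (suc i) (suc j) (ℕ.s≤s i≤j) = lookup-mono sorted i j i≤j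

  spread≤cost : ∀ α D p → (lastOf α D - α) ≤ cost (α ∷ D) p
  spread≤cost α []      p = ≤-trans (x-x≤0 α) (cost≥0 (α ∷ []) p)
  spread≤cost α (β ∷ D) p =
    prove 6 (λ α ω p d e c → p :- α :≤ d :⇒ ω :- p :≤ e :⇒ e :≤ c :⇒ ω :- α :≤ d :+ c)
      (α ∷ ω ∷ p ∷ ∣ α - p ∣ ∷ ∣ ω - p ∣ ∷ cost (β ∷ D) p ∷ [])
      (y-x≤∣x-y∣ α p) (x-y≤∣x-y∣ ω p) (cost-∈ p (lastOf-∈ β D))
    where ω = lastOf β D

  -- If one part of the midpoint cut is empty, a single facility serves all agents, at cost at least
  -- `h`. Otherwise the leftmost agent is in the part of `p` and the rightmost one in the part of
  -- `q`, and each distance is a summand of the cost.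
  one-or-two : ∀ {α D p q h u v} → AllPairs _≤_ (α ∷ D) → p ≤ q →
    (∀ r → h ≤ cost (α ∷ D) r) →
    (h ≤ cost₂ (α ∷ D) p q → u ≤ v) →
    (∣ α - p ∣ ≤ cost₂ (α ∷ D) p q → ∣ lastOf α D - q ∣ ≤ cost₂ (α ∷ D) p q → u ≤ v) →
    u ≤ v
  one-or-two {α} {D} {p} {q} {h} {u} {v} sorted p≤q h-min one two =
    cost₂-split sorted p≤q split
    where
    split : ∀ P Q → P ++ Q ≡ α ∷ D → (cost P p + cost Q q) ≤ cost₂ (α ∷ D) p q → u ≤ v
    split []      Q       refl le = one (≤-trans (h-min q)
      (≤-trans (proj₂ (identityˡ _)) le))
    split P@(_ ∷ _) []    eq   le = one (≤-trans (h-min p)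
      (subst (λ E → cost E p ≤ cost₂ (α ∷ D) p q) (trans (sym (++-identityʳ P)) eq)
        (≤-trans (proj₂ (identityʳ _)) le)))
    split (α ∷ P) (β ∷ Q) refl le = two
      (≤-trans (cost-∈ {α ∷ P} p (here refl)) (≤-trans (x≤x+y (cost≥0 (β ∷ Q) q)) le))
      (subst (λ ω → ∣ ω - q ∣ ≤ cost₂ (α ∷ P ++ β ∷ Q) p q) (sym (lastOf-++ α P β Q))
        (≤-trans (cost-∈ q (lastOf-∈ β Q))
        (≤-trans (≤-trans (x≤x+y (cost≥0 (α ∷ P) p)) (proj₁ (comm _ _))) le)))
      where
      x≤x+y : ∀ {x y} → 0# ≤ y → x ≤ (x + y)
      x≤x+y 0≤y = ≤-trans (proj₂ (identityʳ _)) (+-monoʳ-≤ _ 0≤y)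

-- The potential and its change in each kind of move

module Amortization
  {A : Set} {_≤_ : A → A → Set}
  {_+_ _-_ : A → A → A} {0# : A} { -_ ∣_∣ : A → A} {_⊓_ : A → A → A}
  (isOrderedGroup : IsOrderedGroup _≤_ _+_ _-_ 0# (-_) ∣_∣ _⊓_) where

  open OrderedGroup isOrderedGroup
  open Facilities isOrderedGroup

  dist : A × A → A × A → A
  dist (y₁ , y₂) (x₁ , x₂) = ∣ x₁ - y₁ ∣ + ∣ x₂ - y₂ ∣

  potential : A × A → A × A → A
  potential o x@(x₁ , x₂) = (2 · dist o x) + (x₂ - x₁)

  -- Reduces a move to separate estimates: `u₁`, `u₂` bound the lengths of the movements, `v₁`, `v₂`
  -- the changes of the distances to the partners. The latter may be negative, and that is where
  -- payment comes from.
  potential-≤ : ∀ {y₁ y₂ x₁ x₂ o₁ o₂ u₁ u₂ v₁ v₂ w} →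
    ∣ x₁ - y₁ ∣ ≤ u₁ → ∣ x₂ - y₂ ∣ ≤ u₂ →
    ∣ x₁ - o₁ ∣ ≤ (∣ y₁ - o₁ ∣ + v₁) → ∣ x₂ - o₂ ∣ ≤ (∣ y₂ - o₂ ∣ + v₂) →
    (((u₁ + u₂) + (2 · (v₁ + v₂))) + ((x₂ - x₁) - (y₂ - y₁))) ≤ w →
    (dist (y₁ , y₂) (x₁ , x₂) + potential (o₁ , o₂) (x₁ , x₂)) ≤
    (potential (o₁ , o₂) (y₁ , y₂) + w)
  potential-≤ {y₁} {y₂} {x₁} {x₂} {o₁} {o₂} {u₁} {u₂} {v₁} {v₂} {w} = prove 15
    (λ a b c d e f u₁ u₂ v₁ v₂ w x₁ x₂ y₁ y₂ →
      a :≤ u₁ :⇒ b :≤ u₂ :⇒ c :≤ e :+ v₁ :⇒ d :≤ f :+ v₂ :⇒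
      ((u₁ :+ u₂) :+ 2 :· (v₁ :+ v₂)) :+ ((x₂ :- x₁) :- (y₂ :- y₁)) :≤ w :⇒
      (a :+ b) :+ (2 :· (c :+ d) :+ (x₂ :- x₁)) :≤ (2 :· (e :+ f) :+ (y₂ :- y₁)) :+ w)
    (∣ x₁ - y₁ ∣ ∷ ∣ x₂ - y₂ ∣ ∷ ∣ x₁ - o₁ ∣ ∷ ∣ x₂ - o₂ ∣ ∷ ∣ y₁ - o₁ ∣ ∷ ∣ y₂ - o₂ ∣ ∷
      u₁ ∷ u₂ ∷ v₁ ∷ v₂ ∷ w ∷ x₁ ∷ x₂ ∷ y₁ ∷ y₂ ∷ [])

  module _ {x y o : A} where

    wander : ∀ {u} → ∣ x - y ∣ ≤ u → ∣ x - o ∣ ≤ (∣ y - o ∣ + u)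
    wander {u} le = ∣x-y∣≤z
      (prove 6 (λ x y o d e u → x :- y :≤ e :⇒ y :- o :≤ d :⇒ e :≤ u :⇒ x :- o :≤ d :+ u)
        ρ (x-y≤∣x-y∣ x y) (x-y≤∣x-y∣ y o) le)
      (prove 6 (λ x y o d e u → y :- x :≤ e :⇒ o :- y :≤ d :⇒ e :≤ u :⇒ o :- x :≤ d :+ u)
        ρ (y-x≤∣x-y∣ x y) (y-x≤∣x-y∣ y o) le)
      where ρ = x ∷ y ∷ o ∷ ∣ y - o ∣ ∷ ∣ x - y ∣ ∷ u ∷ []

    -- The part of the way beyond the partner, at most `c`, counts against the facility instead of
    -- for it, whence 2c. The weight 2 of distances turns this into the 4c of Step 1.
    approachˡ : ∀ {c} → 0# ≤ c → x ≤ y → o ≤ (x + c) →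
      ∣ x - o ∣ ≤ (∣ y - o ∣ + ((x - y) + (2 · c)))
    approachˡ {c} 0≤c x≤y o≤x+c = ∣x-y∣≤z
      (prove 5 (λ x y o d c → :0 :≤ c :⇒ y :- o :≤ d :⇒ x :- o :≤ d :+ ((x :- y) :+ 2 :· c))
        ρ 0≤c (x-y≤∣x-y∣ y o))
      (prove 5 (λ x y o d c → o :≤ x :+ c :⇒ y :- o :≤ d :⇒ o :- x :≤ d :+ ((x :- y) :+ 2 :· c))
        ρ o≤x+c (x-y≤∣x-y∣ y o))
      where ρ = x ∷ y ∷ o ∷ ∣ y - o ∣ ∷ c ∷ []

    approachʳ : ∀ {c} → 0# ≤ c → y ≤ x → x ≤ (o + c) →
      ∣ x - o ∣ ≤ (∣ y - o ∣ + ((y - x) + (2 · c)))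
    approachʳ {c} 0≤c y≤x x≤o+c = ∣x-y∣≤z
      (prove 5 (λ x y o d c → x :≤ o :+ c :⇒ o :- y :≤ d :⇒ x :- o :≤ d :+ ((y :- x) :+ 2 :· c))
        ρ x≤o+c (y-x≤∣x-y∣ y o))
      (prove 5 (λ x y o d c → :0 :≤ c :⇒ o :- y :≤ d :⇒ o :- x :≤ d :+ ((y :- x) :+ 2 :· c))
        ρ 0≤c (y-x≤∣x-y∣ y o))
      where ρ = x ∷ y ∷ o ∷ ∣ y - o ∣ ∷ c ∷ []

  moved-right : ∀ {x y} → y ≤ x → ∣ x - y ∣ ≤ (x - y)
  moved-right {x} {y} y≤x = ∣x-y∣≤z ≤-refl
    (prove 2 (λ x y → y :≤ x :⇒ y :- x :≤ x :- y) (x ∷ y ∷ []) y≤x)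

  moved-left : ∀ {x y} → x ≤ y → ∣ x - y ∣ ≤ (y - x)
  moved-left {x} {y} x≤y = ∣x-y∣≤z
    (prove 2 (λ x y → x :≤ y :⇒ x :- y :≤ y :- x) (x ∷ y ∷ []) x≤y) ≤-refl

  stayed : ∀ {x y} → x ≃ y → ∣ x - y ∣ ≤ 0#
  stayed {x} {y} (le , ge) = ∣x-y∣≤z
    (prove 2 (λ x y → x :≤ y :⇒ x :- y :≤ :0) (x ∷ y ∷ []) le)
    (prove 2 (λ x y → y :≤ x :⇒ y :- x :≤ :0) (x ∷ y ∷ []) ge)

  module Step₁ {y₁ y₂ z₁ z₂ o₁ o₂ c : A} (0≤c : 0# ≤ c) where

    private
      Bounded₄ : Set
      Bounded₄ = (dist (y₁ , y₂) (z₁ , z₂) + potential (o₁ , o₂) (z₁ , z₂)) ≤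
                 (potential (o₁ , o₂) (y₁ , y₂) + (4 · c))
      ρ : Vec A 5
      ρ = y₁ ∷ y₂ ∷ z₁ ∷ z₂ ∷ c ∷ []

    none : z₁ ≃ y₁ → z₂ ≃ y₂ → Bounded₄
    none z₁≃y₁ z₂≃y₂ = potential-≤ (stayed z₁≃y₁) (stayed z₂≃y₂)
      (wander (stayed z₁≃y₁)) (wander (stayed z₂≃y₂))
      (prove 5 (λ y₁ y₂ z₁ z₂ c → y₁ :≤ z₁ :⇒ z₂ :≤ y₂ :⇒ :0 :≤ c :⇒
        ((:0 :+ :0) :+ 2 :· (:0 :+ :0)) :+ ((z₂ :- z₁) :- (y₂ :- y₁)) :≤ 4 :· c)
        ρ (proj₂ z₁≃y₁) (proj₁ z₂≃y₂) 0≤c)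

    first : z₁ ≤ y₁ → o₁ ≤ (z₁ + c) → z₂ ≃ y₂ → Bounded₄
    first z₁≤y₁ o₁≤z₁+c z₂≃y₂ = potential-≤ (moved-left z₁≤y₁) (stayed z₂≃y₂)
      (approachˡ 0≤c z₁≤y₁ o₁≤z₁+c) (wander (stayed z₂≃y₂))
      (prove 5 (λ y₁ y₂ z₁ z₂ c → z₂ :≤ y₂ :⇒
        (((y₁ :- z₁) :+ :0) :+ 2 :· (((z₁ :- y₁) :+ 2 :· c) :+ :0)) :+
          ((z₂ :- z₁) :- (y₂ :- y₁)) :≤ 4 :· c)
        ρ (proj₁ z₂≃y₂))

    second : z₁ ≃ y₁ → y₂ ≤ z₂ → z₂ ≤ (o₂ + c) → Bounded₄
    second z₁≃y₁ y₂≤z₂ z₂≤o₂+c = potential-≤ (stayed z₁≃y₁) (moved-right y₂≤z₂)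
      (wander (stayed z₁≃y₁)) (approachʳ 0≤c y₂≤z₂ z₂≤o₂+c)
      (prove 5 (λ y₁ y₂ z₁ z₂ c → y₁ :≤ z₁ :⇒
        ((:0 :+ (z₂ :- y₂)) :+ 2 :· (:0 :+ ((y₂ :- z₂) :+ 2 :· c))) :+
          ((z₂ :- z₁) :- (y₂ :- y₁)) :≤ 4 :· c)
        ρ (proj₂ z₁≃y₁))

    -- The condition on the sums says that the first facility, which may recede from its partner,
    -- moves no farther than the second one approaches its own. The gap shrinks by the total
    -- movement and pays for it.
    both-second : y₁ ≤ z₁ → z₂ ≤ y₂ → (z₁ + z₂) ≤ (y₁ + y₂) → o₂ ≤ (z₂ + c) → Bounded₄
    both-second y₁≤z₁ z₂≤y₂ bal o₂≤z₂+c = potential-≤ (moved-right y₁≤z₁) (moved-left z₂≤y₂)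
      (wander (moved-right y₁≤z₁)) (approachˡ 0≤c z₂≤y₂ o₂≤z₂+c)
      (prove 5 (λ y₁ y₂ z₁ z₂ c → z₁ :+ z₂ :≤ y₁ :+ y₂ :⇒
        (((z₁ :- y₁) :+ (y₂ :- z₂)) :+ 2 :· ((z₁ :- y₁) :+ ((z₂ :- y₂) :+ 2 :· c))) :+
          ((z₂ :- z₁) :- (y₂ :- y₁)) :≤ 4 :· c)
        ρ bal)

    both-first : y₁ ≤ z₁ → z₂ ≤ y₂ → (y₁ + y₂) ≤ (z₁ + z₂) → z₁ ≤ (o₁ + c) → Bounded₄
    both-first y₁≤z₁ z₂≤y₂ bal z₁≤o₁+c = potential-≤ (moved-right y₁≤z₁) (moved-left z₂≤y₂)
      (approachʳ 0≤c y₁≤z₁ z₁≤o₁+c) (wander (moved-left z₂≤y₂))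
      (prove 5 (λ y₁ y₂ z₁ z₂ c → y₁ :+ y₂ :≤ z₁ :+ z₂ :⇒
        (((z₁ :- y₁) :+ (y₂ :- z₂)) :+ 2 :· (((y₁ :- z₁) :+ 2 :· c) :+ (y₂ :- z₂))) :+
          ((z₂ :- z₁) :- (y₂ :- y₁)) :≤ 4 :· c)
        ρ bal)

  module Step₂ {α ω h c k o₁ o₂ z₁ z₂ x₁ x₂ : A} (0≤c : 0# ≤ c) where

    private
      -- `k` stands for the algorithm's connection cost and `h` for H(C). The 59 is what Step 1
      -- leaves of 63. The most demanding case is `near`, with 33c: 8h for movement, 16h for
      -- distances, 8h for the gap, and `k`.
      Bounded₅₉ : Set
      Bounded₅₉ = (dist (z₁ , z₂) (x₁ , x₂) + potential (o₁ , o₂) (x₁ , x₂)) ≤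
                  (potential (o₁ , o₂) (z₁ , z₂) + ((59 · c) - k))

    near : h ≤ c → k ≤ c → ∣ x₁ - z₁ ∣ ≤ (4 · h) → ∣ x₂ - z₂ ∣ ≤ (4 · h) → Bounded₅₉
    near h≤c k≤c move₁ move₂ = potential-≤ move₁ move₂ (wander move₁) (wander move₂)
      (prove 9 (λ x₁ x₂ z₁ z₂ d₁ d₂ h c k → z₁ :- x₁ :≤ d₁ :⇒ x₂ :- z₂ :≤ d₂ :⇒
        h :≤ c :⇒ k :≤ c :⇒ :0 :≤ c :⇒ d₁ :≤ 4 :· h :⇒ d₂ :≤ 4 :· h :⇒
        ((4 :· h :+ 4 :· h) :+ 2 :· (4 :· h :+ 4 :· h)) :+
          ((x₂ :- x₁) :- (z₂ :- z₁)) :≤ 59 :· c :- k)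
        (x₁ ∷ x₂ ∷ z₁ ∷ z₂ ∷ ∣ x₁ - z₁ ∣ ∷ ∣ x₂ - z₂ ∣ ∷ h ∷ c ∷ k ∷ [])
        (y-x≤∣x-y∣ x₁ z₁) (x-y≤∣x-y∣ x₂ z₂) h≤c k≤c 0≤c move₁ move₂)

    within : (ω - α) ≤ h → ∀ {a b} → α ≤ a → b ≤ ω → (b - a) ≤ h
    within D≤h {a} {b} = prove 5 (λ α ω h a b → ω :- α :≤ h :⇒ α :≤ a :⇒
      b :≤ ω :⇒ b :- a :≤ h) (α ∷ ω ∷ h ∷ a ∷ b ∷ []) D≤h

    -- Moving the second facility by 3h costs 3h, but lowers the potential by 6h through the
    -- distance, up to 4c, and by 3h through the gap: 6h are gained. The first facility moves by at
    -- most `h` and needs 4h: `h` for movement, 2h for distance, `h` for the gap. The remaining 2h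
    -- cover `k`.
    retreat₂ : k ≤ h → 0# ≤ h → (ω - α) ≤ h → α ≤ z₁ → z₁ ≤ ω → α ≤ x₁ → x₁ ≤ ω →
      x₂ ≃ (z₂ - (3 · h)) → o₂ ≤ (x₂ + c) → Bounded₅₉
    retreat₂ k≤h 0≤h D≤h α≤z₁ z₁≤ω α≤x₁ x₁≤ω (x₂≤ , ≤x₂) o₂≤x₂+c =
      potential-≤ move₁ (moved-left x₂≤z₂) (wander move₁) (approachˡ 0≤c x₂≤z₂ o₂≤x₂+c)
        (prove 7 (λ x₁ x₂ z₁ z₂ h c k → k :≤ h :⇒ :0 :≤ h :⇒ :0 :≤ c :⇒ z₁ :- x₁ :≤ h :⇒
          x₂ :≤ z₂ :- 3 :· h :⇒ z₂ :- 3 :· h :≤ x₂ :⇒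
          ((h :+ (z₂ :- x₂)) :+ 2 :· (h :+ ((x₂ :- z₂) :+ 2 :· c))) :+
            ((x₂ :- x₁) :- (z₂ :- z₁)) :≤ 59 :· c :- k)
          (x₁ ∷ x₂ ∷ z₁ ∷ z₂ ∷ h ∷ c ∷ k ∷ []) k≤h 0≤h 0≤c (within D≤h α≤x₁ z₁≤ω) x₂≤ ≤x₂)
      where
      move₁ : ∣ x₁ - z₁ ∣ ≤ h
      move₁ = ∣x-y∣≤z (within D≤h α≤z₁ x₁≤ω) (within D≤h α≤x₁ z₁≤ω)
      x₂≤z₂ : x₂ ≤ z₂
      x₂≤z₂ = prove 3 (λ x₂ z₂ h → x₂ :≤ z₂ :- 3 :· h :⇒ :0 :≤ h :⇒ x₂ :≤ z₂)
        (x₂ ∷ z₂ ∷ h ∷ []) x₂≤ 0≤h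

    retreat₁ : k ≤ h → 0# ≤ h → (ω - α) ≤ h → α ≤ z₂ → z₂ ≤ ω → α ≤ x₂ → x₂ ≤ ω →
      x₁ ≃ (z₁ + (3 · h)) → x₁ ≤ (o₁ + c) → Bounded₅₉
    retreat₁ k≤h 0≤h D≤h α≤z₂ z₂≤ω α≤x₂ x₂≤ω (x₁≤ , ≤x₁) x₁≤o₁+c =
      potential-≤ (moved-right z₁≤x₁) move₂ (approachʳ 0≤c z₁≤x₁ x₁≤o₁+c) (wander move₂)
        (prove 7 (λ x₁ x₂ z₁ z₂ h c k → k :≤ h :⇒ :0 :≤ h :⇒ :0 :≤ c :⇒ x₂ :- z₂ :≤ h :⇒
          x₁ :≤ z₁ :+ 3 :· h :⇒ z₁ :+ 3 :· h :≤ x₁ :⇒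
          (((x₁ :- z₁) :+ h) :+ 2 :· (((z₁ :- x₁) :+ 2 :· c) :+ h)) :+
            ((x₂ :- x₁) :- (z₂ :- z₁)) :≤ 59 :· c :- k)
          (x₁ ∷ x₂ ∷ z₁ ∷ z₂ ∷ h ∷ c ∷ k ∷ []) k≤h 0≤h 0≤c (within D≤h α≤z₂ x₂≤ω) x₁≤ ≤x₁)
      where
      move₂ : ∣ x₂ - z₂ ∣ ≤ h
      move₂ = ∣x-y∣≤z (within D≤h α≤z₂ x₂≤ω) (within D≤h α≤x₂ z₂≤ω)
      z₁≤x₁ : z₁ ≤ x₁
      z₁≤x₁ = prove 3 (λ x₁ z₁ h → z₁ :+ 3 :· h :≤ x₁ :⇒ :0 :≤ h :⇒ z₁ :≤ x₁)
        (x₁ ∷ z₁ ∷ h ∷ []) ≤x₁ 0≤h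

    -- A facility at distance d from its partner travels at most d + 2c and ends within 2c of the
    -- partner. The distance term releases 2d, one d for the travel and one for the growth of the
    -- gap; 8c per facility are left to pay.
    matched : k ≤ c → ∣ α - o₁ ∣ ≤ c → ∣ ω - o₂ ∣ ≤ c → ∣ α - x₁ ∣ ≤ c → ∣ ω - x₂ ∣ ≤ c →
      Bounded₅₉
    matched k≤c αo ωo αx ωx =
      potential-≤ (moved αo αx) (moved ωo ωx) (reaches αo αx) (reaches ωo ωx)
        (prove 10 (λ z₁ z₂ o₁ o₂ x₁ x₂ k c d e →
          z₁ :- o₁ :≤ d :⇒ o₂ :- z₂ :≤ e :⇒ o₁ :- x₁ :≤ 2 :· c :⇒ x₂ :- o₂ :≤ 2 :· c :⇒
          :0 :≤ c :⇒ k :≤ c :⇒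
          (((d :+ 2 :· c) :+ (e :+ 2 :· c)) :+ 2 :· ((2 :· c :- d) :+ (2 :· c :- e))) :+
            ((x₂ :- x₁) :- (z₂ :- z₁)) :≤ 59 :· c :- k)
          (z₁ ∷ z₂ ∷ o₁ ∷ o₂ ∷ x₁ ∷ x₂ ∷ k ∷ c ∷ ∣ z₁ - o₁ ∣ ∷ ∣ z₂ - o₂ ∣ ∷ [])
          (x-y≤∣x-y∣ z₁ o₁) (y-x≤∣x-y∣ z₂ o₂) (apart αx αo) (apart ωo ωx) 0≤c k≤c)
      where
      apart : ∀ {α o x} → ∣ α - o ∣ ≤ c → ∣ α - x ∣ ≤ c → (x - o) ≤ (2 · c)
      apart {α} {o} {x} αo αx = prove 6 (λ α o x d e c → α :- o :≤ d :⇒ x :- α :≤ e :⇒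
        d :≤ c :⇒ e :≤ c :⇒ x :- o :≤ 2 :· c)
        (α ∷ o ∷ x ∷ ∣ α - o ∣ ∷ ∣ α - x ∣ ∷ c ∷ [])
        (x-y≤∣x-y∣ α o) (y-x≤∣x-y∣ α x) αo αx
      moved : ∀ {α o x z} → ∣ α - o ∣ ≤ c → ∣ α - x ∣ ≤ c →
        ∣ x - z ∣ ≤ (∣ z - o ∣ + (2 · c))
      moved {o = o} {x} {z} αo αx = ∣x-y∣≤z
        (prove 5 (λ o x z d c → o :- z :≤ d :⇒ x :- o :≤ 2 :· c :⇒ x :- z :≤ d :+ 2 :· c)
          ρ (y-x≤∣x-y∣ z o) (apart αo αx))
        (prove 5 (λ o x z d c → z :- o :≤ d :⇒ o :- x :≤ 2 :· c :⇒ z :- x :≤ d :+ 2 :· c)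
          ρ (x-y≤∣x-y∣ z o) (apart αx αo))
        where ρ = o ∷ x ∷ z ∷ ∣ z - o ∣ ∷ c ∷ []
      reaches : ∀ {α o x z} → ∣ α - o ∣ ≤ c → ∣ α - x ∣ ≤ c →
        ∣ x - o ∣ ≤ (∣ z - o ∣ + ((2 · c) - ∣ z - o ∣))
      reaches {o = o} {x} {z} αo αx = ≤-trans (∣x-y∣≤z (apart αo αx) (apart αx αo))
        (prove 2 (λ c d → 2 :· c :≤ d :+ (2 :· c :- d)) (c ∷ ∣ z - o ∣ ∷ []))

    Dichotomy : Set
    Dichotomy = (h ≤ c) ⊎ (∣ α - o₁ ∣ ≤ c) × (∣ ω - o₂ ∣ ≤ c)

    private
      ≤4h : ∀ {d} → 0# ≤ h → d ≤ h → d ≤ (4 · h)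
      ≤4h {d} = prove 2 (λ d h → :0 :≤ h :⇒ d :≤ h :⇒ d :≤ 4 :· h) (d ∷ h ∷ [])

      3h-bound : ∀ {x z} → 0# ≤ h → (x - z) ≤ (3 · h) → (z - x) ≤ (3 · h) → ∣ x - z ∣ ≤ (4 · h)
      3h-bound {x} {z} 0≤h le ge = ∣x-y∣≤z (lift le) (lift ge)
        where
        lift : ∀ {d} → d ≤ (3 · h) → d ≤ (4 · h)
        lift {d} = prove 2 (λ d h → :0 :≤ h :⇒ d :≤ 3 :· h :⇒ d :≤ 4 :· h) (d ∷ h ∷ []) 0≤h

    caseᵃ : Dichotomy → k ≤ h → 0# ≤ h → (ω - α) ≤ h → α ≤ z₁ → z₁ ≤ ω → α ≤ x₁ → x₁ ≤ ω →
      (3 · h) ≤ (z₂ - ω) → x₂ ≃ (z₂ - (3 · h)) → Bounded₅₉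
    caseᵃ (inj₁ h≤c) k≤h 0≤h D≤h α≤z₁ z₁≤ω α≤x₁ x₁≤ω far (x₂≤ , ≤x₂) = near h≤c (≤-trans k≤h h≤c)
      (≤4h 0≤h (∣x-y∣≤z (within D≤h α≤z₁ x₁≤ω) (within D≤h α≤x₁ z₁≤ω)))
      (3h-bound 0≤h
        (prove 3 (λ x z h → :0 :≤ h :⇒ x :≤ z :- 3 :· h :⇒ x :- z :≤ 3 :· h)
          (x₂ ∷ z₂ ∷ h ∷ []) 0≤h x₂≤)
        (prove 3 (λ x z h → z :- 3 :· h :≤ x :⇒ z :- x :≤ 3 :· h) (x₂ ∷ z₂ ∷ h ∷ []) ≤x₂))
    caseᵃ (inj₂ (_ , ωo)) k≤h 0≤h D≤h α≤z₁ z₁≤ω α≤x₁ x₁≤ω far x₂≃ =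
      retreat₂ k≤h 0≤h D≤h α≤z₁ z₁≤ω α≤x₁ x₁≤ω x₂≃
        (prove 7 (λ ω o c d x z h → o :- ω :≤ d :⇒ d :≤ c :⇒ 3 :· h :≤ z :- ω :⇒
          z :- 3 :· h :≤ x :⇒ o :≤ x :+ c)
          (ω ∷ o₂ ∷ c ∷ ∣ ω - o₂ ∣ ∷ x₂ ∷ z₂ ∷ h ∷ []) (y-x≤∣x-y∣ ω o₂) ωo far (proj₂ x₂≃))

    caseᵇ : Dichotomy → k ≤ h → 0# ≤ h → (ω - α) ≤ h → α ≤ z₂ → z₂ ≤ ω → α ≤ x₂ → x₂ ≤ ω →
      (3 · h) ≤ (α - z₁) → x₁ ≃ (z₁ + (3 · h)) → Bounded₅₉
    caseᵇ (inj₁ h≤c) k≤h 0≤h D≤h α≤z₂ z₂≤ω α≤x₂ x₂≤ω far (x₁≤ , ≤x₁) = near h≤c (≤-trans k≤h h≤c)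
      (3h-bound 0≤h
        (prove 3 (λ x z h → x :≤ z :+ 3 :· h :⇒ x :- z :≤ 3 :· h) (x₁ ∷ z₁ ∷ h ∷ []) x₁≤)
        (prove 3 (λ x z h → :0 :≤ h :⇒ z :+ 3 :· h :≤ x :⇒ z :- x :≤ 3 :· h)
          (x₁ ∷ z₁ ∷ h ∷ []) 0≤h ≤x₁))
      (≤4h 0≤h (∣x-y∣≤z (within D≤h α≤z₂ x₂≤ω) (within D≤h α≤x₂ z₂≤ω)))
    caseᵇ (inj₂ (αo , _)) k≤h 0≤h D≤h α≤z₂ z₂≤ω α≤x₂ x₂≤ω far x₁≃ =
      retreat₁ k≤h 0≤h D≤h α≤z₂ z₂≤ω α≤x₂ x₂≤ω x₁≃
        (prove 7 (λ α o c d x z h → α :- o :≤ d :⇒ d :≤ c :⇒ 3 :· h :≤ α :- z :⇒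
          x :≤ z :+ 3 :· h :⇒ x :≤ o :+ c)
          (α ∷ o₁ ∷ c ∷ ∣ α - o₁ ∣ ∷ x₁ ∷ z₁ ∷ h ∷ []) (x-y≤∣x-y∣ α o₁) αo far (proj₁ x₁≃))

    -- The factor 4 of `near` originates here: a facility starts at most 3h outside the range of the
    -- agents and ends inside that range, whose length is at most `h`.
    caseᶜ : Dichotomy → k ≤ c → 0# ≤ h → (ω - α) ≤ h →
      z₁ ≤ ω → α ≤ z₂ → (α - z₁) ≤ (3 · h) → (z₂ - ω) ≤ (3 · h) →
      α ≤ x₁ → x₁ ≤ ω → α ≤ x₂ → x₂ ≤ ω → ∣ α - x₁ ∣ ≤ c → ∣ ω - x₂ ∣ ≤ c → Bounded₅₉
    caseᶜ (inj₁ h≤c) k≤c 0≤h D≤h z₁≤ω α≤z₂ α-z₁≤3h z₂-ω≤3h α≤x₁ x₁≤ω α≤x₂ x₂≤ω _ _ = near h≤c k≤c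
      (∣x-y∣≤z
        (prove 5 (λ α ω h x z → ω :- α :≤ h :⇒ α :- z :≤ 3 :· h :⇒ x :≤ ω :⇒ x :- z :≤ 4 :· h)
          (α ∷ ω ∷ h ∷ x₁ ∷ z₁ ∷ []) D≤h α-z₁≤3h x₁≤ω)
        (≤4h 0≤h (within D≤h α≤x₁ z₁≤ω)))
      (∣x-y∣≤z
        (≤4h 0≤h (within D≤h α≤z₂ x₂≤ω))
        (prove 5 (λ α ω h x z → ω :- α :≤ h :⇒ z :- ω :≤ 3 :· h :⇒ α :≤ x :⇒ z :- x :≤ 4 :· h)
          (α ∷ ω ∷ h ∷ x₂ ∷ z₂ ∷ []) D≤h z₂-ω≤3h α≤x₂))
    caseᶜ (inj₂ (αo , ωo)) k≤c _ _ _ _ _ _ _ _ _ _ αx ωx = matched k≤c αo ωo αx ωx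

  dist≥0 : ∀ y x → 0# ≤ dist y x
  dist≥0 (y₁ , y₂) (x₁ , x₂) = ≤-trans (proj₂ (identityˡ 0#))
    (+-mono-≤ (0≤∣x-y∣ x₁ y₁) (0≤∣x-y∣ x₂ y₂))

  dist-triangle : ∀ y z x → dist y x ≤ (dist y z + dist z x)
  dist-triangle (y₁ , y₂) (z₁ , z₂) (x₁ , x₂) =
    prove 6 (λ a a′ b b′ c c′ → a :≤ b :+ c :⇒ a′ :≤ b′ :+ c′ :⇒
        a :+ a′ :≤ (b :+ b′) :+ (c :+ c′))
      (∣ x₁ - y₁ ∣ ∷ ∣ x₂ - y₂ ∣ ∷ ∣ z₁ - y₁ ∣ ∷ ∣ z₂ - y₂ ∣ ∷ ∣ x₁ - z₁ ∣ ∷ ∣ x₂ - z₂ ∣ ∷ [])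
      (wander ≤-refl) (wander ≤-refl)

  two-steps : ∀ {y z x o c k} →
    (dist y z + potential o z) ≤ (potential o y + (4 · c)) →
    (dist z x + potential o x) ≤ (potential o z + ((59 · c) - k)) →
    ((dist y x + k) + potential o x) ≤ (potential o y + (63 · c))
  two-steps {y} {z} {x} {o} {c} {k} = prove 8
    (λ yx yz zx py pz px c k → yx :≤ yz :+ zx :⇒ yz :+ pz :≤ py :+ 4 :· c :⇒
      zx :+ px :≤ pz :+ (59 :· c :- k) :⇒ (yx :+ k) :+ px :≤ py :+ 63 :· c)
    (dist y x ∷ dist y z ∷ dist z x ∷ potential o y ∷ potential o z ∷ potential o x ∷
      c ∷ k ∷ []) (dist-triangle y z x)

  symmetricPotential : A × A → A × A → A
  symmetricPotential o x@(x₁ , x₂) = (2 · (dist o x ⊓ dist (swap o) x)) + (x₂ - x₁)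

  private
    u+∣x-y∣≤v : ∀ {u x y v} → (u + (x - y)) ≤ v → (u + (y - x)) ≤ v → (u + ∣ x - y ∣) ≤ v
    u+∣x-y∣≤v {u} {x} {y} {v} le ge =
      prove 3 (λ u d v → d :≤ v :- u :⇒ u :+ d :≤ v) (u ∷ ∣ x - y ∣ ∷ v ∷ [])
        (∣x-y∣≤z (transpose le) (transpose ge))
      where
      transpose : ∀ {x y} → (u + (x - y)) ≤ v → (x - y) ≤ (v - u)
      transpose {x} {y} = prove 4 (λ x y u v → u :+ (x :- y) :≤ v :⇒ x :- y :≤ v :- u)
        (x ∷ y ∷ u ∷ v ∷ [])

  -- The four inequalities are the sign choices for the absolute values on the left. Equal signs
  -- only need a rearrangement of the sum; opposite signs need one of the two orders.
  dist-uncross : ∀ {x₁ x₂ o₁ o₂} → x₁ ≤ x₂ → o₁ ≤ o₂ →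
    dist (o₁ , o₂) (x₁ , x₂) ≤ dist (o₂ , o₁) (x₁ , x₂)
  dist-uncross {x₁} {x₂} {o₁} {o₂} x₁≤x₂ o₁≤o₂ = u+∣x-y∣≤v
    (≤-trans (proj₁ (comm _ _)) (u+∣x-y∣≤v
      (prove 6 (λ x₁ x₂ o₁ o₂ d e → x₁ :- o₂ :≤ d :⇒ x₂ :- o₁ :≤ e :⇒
        (x₂ :- o₂) :+ (x₁ :- o₁) :≤ d :+ e)
        ρ (x-y≤∣x-y∣ x₁ o₂) (x-y≤∣x-y∣ x₂ o₁))
      (prove 6 (λ x₁ x₂ o₁ o₂ d e → o₁ :≤ o₂ :⇒ x₁ :- o₂ :≤ d :⇒ o₂ :- x₁ :≤ d :⇒ x₂ :- o₁ :≤ e :⇒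
        (x₂ :- o₂) :+ (o₁ :- x₁) :≤ d :+ e)
        ρ o₁≤o₂ (x-y≤∣x-y∣ x₁ o₂) (y-x≤∣x-y∣ x₁ o₂) (x-y≤∣x-y∣ x₂ o₁))))
    (≤-trans (proj₁ (comm _ _)) (u+∣x-y∣≤v
      (prove 6 (λ x₁ x₂ o₁ o₂ d e → x₁ :≤ x₂ :⇒ o₂ :- x₁ :≤ d :⇒ x₂ :- o₁ :≤ e :⇒
        (o₂ :- x₂) :+ (x₁ :- o₁) :≤ d :+ e)
        ρ x₁≤x₂ (y-x≤∣x-y∣ x₁ o₂) (x-y≤∣x-y∣ x₂ o₁))
      (prove 6 (λ x₁ x₂ o₁ o₂ d e → o₂ :- x₁ :≤ d :⇒ o₁ :- x₂ :≤ e :⇒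
        (o₂ :- x₂) :+ (o₁ :- x₁) :≤ d :+ e)
        ρ (y-x≤∣x-y∣ x₁ o₂) (y-x≤∣x-y∣ x₂ o₁))))
    where
    ρ : Vec A 6
    ρ = x₁ ∷ x₂ ∷ o₁ ∷ o₂ ∷ ∣ x₁ - o₂ ∣ ∷ ∣ x₂ - o₁ ∣ ∷ []

  -- After the move the minimum is at most the cost of the ordered matching anyway; before it,
  -- `dist-uncross` shows that the ordered matching attains the minimum.
  amortized : ∀ {C y₁ y₂ x₁ x₂ k} → y₁ ≤ y₂ →
    (∀ {o₁ o₂} → o₁ ≤ o₂ →
      ((dist (y₁ , y₂) (x₁ , x₂) + k) + potential (o₁ , o₂) (x₁ , x₂)) ≤
      (potential (o₁ , o₂) (y₁ , y₂) + (63 · cost₂ C o₁ o₂))) →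
    ∀ o → ((dist (y₁ , y₂) (x₁ , x₂) + k) + symmetricPotential o (x₁ , x₂)) ≤
          (symmetricPotential o (y₁ , y₂) + (63 · cost₂ C (proj₁ o) (proj₂ o)))
  amortized {C} {y₁} {y₂} {x₁} {x₂} {k} y₁≤y₂ bound (o₁ , o₂) = ≤-cases o₁ o₂
    (λ o₁≤o₂ → conclude (x⊓y≤x _ _) (⊓-glb ≤-refl (dist-uncross y₁≤y₂ o₁≤o₂))
      ≤-refl (bound o₁≤o₂))
    (λ o₂≤o₁ → conclude (x⊓y≤y _ _) (⊓-glb (dist-uncross y₁≤y₂ o₂≤o₁) ≤-refl)
      (cost₂-comm C o₂ o₁) (bound o₂≤o₁))
    where
    conclude : ∀ {a b d e c c′} → a ≤ b → d ≤ e → c ≤ c′ →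
      ((dist (y₁ , y₂) (x₁ , x₂) + k) + ((2 · b) + (x₂ - x₁))) ≤
      (((2 · d) + (y₂ - y₁)) + (63 · c)) →
      ((dist (y₁ , y₂) (x₁ , x₂) + k) + ((2 · a) + (x₂ - x₁))) ≤
      (((2 · e) + (y₂ - y₁)) + (63 · c′))
    conclude {a} {b} {d} {e} {c} {c′} = prove 9
      (λ a b d e c c′ m x y → a :≤ b :⇒ d :≤ e :⇒ c :≤ c′ :⇒
        m :+ (2 :· b :+ x) :≤ (2 :· d :+ y) :+ 63 :· c :⇒
        m :+ (2 :· a :+ x) :≤ (2 :· e :+ y) :+ 63 :· c′)
      (a ∷ b ∷ d ∷ e ∷ c ∷ c′ ∷ (dist (y₁ , y₂) (x₁ , x₂) + k) ∷ (x₂ - x₁) ∷ (y₂ - y₁) ∷ [])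

  dist-comm : ∀ x y → dist x y ≤ dist y x
  dist-comm (x₁ , x₂) (y₁ , y₂) = +-mono-≤
    (∣x-y∣≤z (y-x≤∣x-y∣ x₁ y₁) (x-y≤∣x-y∣ x₁ y₁))
    (∣x-y∣≤z (y-x≤∣x-y∣ x₂ y₂) (x-y≤∣x-y∣ x₂ y₂))

  symmetricPotential-drift : ∀ o o′ x →
    symmetricPotential o′ x ≤ (symmetricPotential o x + (2 · dist o o′))
  symmetricPotential-drift o@(o₁ , o₂) o′@(o₁′ , o₂′) x@(x₁ , x₂) =
    prove 4 (λ a b d x → a :- d :≤ b :⇒ 2 :· a :+ x :≤ (2 :· b :+ x) :+ 2 :· d)
      ((dist o′ x ⊓ dist (swap o′) x) ∷ (dist o x ⊓ dist (swap o) x) ∷ dist o o′ ∷ (x₂ - x₁) ∷ [])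
      (⊓-glb (transpose (≤-trans (x⊓y≤x _ _)
               (≤-trans (dist-triangle o′ o x) (+-mono-≤ (dist-comm o′ o) ≤-refl))))
             (transpose (≤-trans (x⊓y≤y _ _)
               (≤-trans (dist-triangle (swap o′) (swap o) x)
               (+-mono-≤ (≤-trans (dist-comm (swap o′) (swap o)) (proj₁ (comm _ _))) ≤-refl)))))
    where
    transpose : ∀ {a b d} → a ≤ (d + b) → (a - d) ≤ b
    transpose {a} {b} {d} = prove 3 (λ a b d → a :≤ d :+ b :⇒ a :- d :≤ b) (a ∷ b ∷ d ∷ [])

  -- The other solution's move is charged first, while the algorithm is still at `y`. It takes 2 of
  -- the 63 times its length that are available.
  amortized-drift : ∀ c {a} o o′ y x →
    (a + symmetricPotential o′ x) ≤ (symmetricPotential o′ y + (63 · c)) →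
    (a + symmetricPotential o′ x) ≤ (symmetricPotential o y + (63 · (dist o o′ + c)))
  amortized-drift c {a} o o′ y x =
    prove 6 (λ a p q r d c → q :≤ r :+ 2 :· d :⇒ :0 :≤ d :⇒ a :+ p :≤ q :+ 63 :· c :⇒
        a :+ p :≤ r :+ 63 :· (d :+ c))
      (a ∷ symmetricPotential o′ x ∷ symmetricPotential o′ y ∷ symmetricPotential o y ∷
        dist o o′ ∷ c ∷ [])
      (symmetricPotential-drift o o′ y) (dist≥0 o o′)

  -- symmetricPotential p p is the signed distance between the facilities.
  initial-final : ∀ {a b} p o x → proj₁ x ≤ proj₂ x →
    (a + symmetricPotential o x) ≤ (symmetricPotential p p + b) →
    a ≤ (b + ∣ proj₁ p - proj₂ p ∣)
  initial-final {a} {b} p@(p₁ , p₂) o x@(x₁ , x₂) x₁≤x₂ =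
    prove 9 (λ a b m k x₁ x₂ p₁ p₂ d → x₁ :≤ x₂ :⇒ :0 :≤ m :⇒ k :≤ :0 :⇒ p₂ :- p₁ :≤ d :⇒
        a :+ (2 :· m :+ (x₂ :- x₁)) :≤ (2 :· k :+ (p₂ :- p₁)) :+ b :⇒ a :≤ b :+ d)
      (a ∷ b ∷ (dist o x ⊓ dist (swap o) x) ∷ (dist p p ⊓ dist (swap p) p) ∷
        x₁ ∷ x₂ ∷ p₁ ∷ p₂ ∷ ∣ p₁ - p₂ ∣ ∷ [])
      x₁≤x₂ (⊓-glb (dist≥0 o x) (dist≥0 (swap o) x))
      (≤-trans (x⊓y≤x _ _) (≤-trans
        (+-mono-≤ (∣x-y∣≤z (x-x≤0 p₁) (x-x≤0 p₁)) (∣x-y∣≤z (x-x≤0 p₂) (x-x≤0 p₂)))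
        (proj₁ (identityˡ 0#))))
      (y-x≤∣x-y∣ p₁ p₂)

  telescope : ∀ {T} (a b : Fin T → A) (Φ : Fin (suc T) → A) →
    (∀ t → (a t + Φ (suc t)) ≤ (Φ (inject₁ t) + (63 · b t))) →
    (sum (List.tabulate a) + Φ (fromℕ T)) ≤ (Φ zero + (63 · sum (List.tabulate b)))
  telescope {zero}  a b Φ step = prove 1 (λ x → :0 :+ x :≤ x :+ 63 :· :0) (Φ zero ∷ [])
  telescope {suc T} a b Φ step =
    prove 7 (λ a b s t φ₀ φ₁ φ → a :+ φ₁ :≤ φ₀ :+ 63 :· b :⇒ s :+ φ :≤ φ₁ :+ 63 :· t :⇒
        (a :+ s) :+ φ :≤ φ₀ :+ 63 :· (b :+ t))
      (a zero ∷ b zero ∷ sum (List.tabulate (a ∘ suc)) ∷ sum (List.tabulate (b ∘ suc)) ∷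
        Φ zero ∷ Φ (suc zero) ∷ Φ (fromℕ (suc T)) ∷ [])
      (step zero) (telescope (a ∘ suc) (b ∘ suc) (Φ ∘ suc) (step ∘ suc))

-- Analysis of Step 1

module FirstStep
  {A : Set} {_≤_ : A → A → Set}
  {_+_ _-_ : A → A → A} {0# : A} { -_ ∣_∣ : A → A} {_⊓_ : A → A → A}
  (isOrderedGroup : IsOrderedGroup _≤_ _+_ _-_ 0# (-_) ∣_∣ _⊓_)
  (_<_ : A → A → Set) (<⇒≱ : ∀ {x y} → x < y → ¬ (y ≤ x)) (≮⇒≥ : ∀ {x y} → ¬ (x < y) → y ≤ x)
  where

  open OrderedGroup isOrderedGroup
  open Facilities isOrderedGroup
  open Amortization isOrderedGroup

  <⇒≤ : ∀ {x y} → x < y → x ≤ y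
  <⇒≤ {x} {y} x<y = ≤-cases x y (λ x≤y → x≤y) (⊥-elim ∘ <⇒≱ x<y)

  -- If the goal failed, `onTrue` would refute `P`; then the else branch is available and yields the
  -- goal after all.
  if-cases : ∀ {P T E : Set} {u v} → If P Then T Else E →
    (P → T → u ≤ v) → (¬ P → E → u ≤ v) → u ≤ v
  if-cases (then , else) onTrue onFalse = ≤-stable λ ≰ →
    ≰ (onFalse (λ p → ≰ (onTrue p (then p))) (else λ p → ≰ (onTrue p (then p))))

  module _ {α ω : A} (α≤ω : α ≤ ω) where

    -- `side` excludes that the agents lie strictly between the facilities. The alternatives in
    -- `bound` tell which facility approaches its partner when both move inwards.
    record AfterStep₁ (y₁ y₂ z₁ z₂ : A) : Set where
      field
        z₁≤ω  : z₁ ≤ ω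
        α≤z₂  : α ≤ z₂
        side  : α ≤ z₁ ⊎ z₂ ≤ ω
        bound : ∀ {o₁ o₂ c} → 0# ≤ c → o₁ ≤ (ω + c) → α ≤ (o₂ + c) →
          (o₂ ≤ (ω + c) ⊎ α ≤ (o₁ + c)) →
          (dist (y₁ , y₂) (z₁ , z₂) + potential (o₁ , o₂) (z₁ , z₂)) ≤
          (potential (o₁ , o₂) (y₁ , y₂) + (4 · c))

    private
      infixr 5 _⨾_
      _⨾_ : ∀ {x y z} → x ≤ y → y ≤ z → x ≤ z
      _⨾_ = ≤-trans

    step₁ : ∀ {y₁ y₂ w₁ w₂ z₁ z₂ u v} → let δ = ∣ y₁ - α ∣ ⊓ ∣ y₂ - ω ∣ in y₁ ≤ y₂ →
      (If ω < y₁ Then w₁ ≃ ω Else w₁ ≃ y₁) →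
      (If y₂ < α Then w₂ ≃ α Else w₂ ≃ y₂) →
      (If w₁ < α × ω < w₂ Then z₁ ≃ (w₁ + δ) × z₂ ≃ (w₂ - δ) Else z₁ ≃ w₁ × z₂ ≃ w₂) →
      (AfterStep₁ y₁ y₂ z₁ z₂ → u ≤ v) → u ≤ v
    step₁ {y₁} {y₂} {w₁} {w₂} {z₁} {z₂} {u} {v} y₁≤y₂ if₁ if₂ if₃ k =
      if-cases if₁
        (λ ω<y₁ w₁≃ω → if-cases if₂
          (λ y₂<α _ → ⊥-elim (<⇒≱ y₂<α (α≤ω ⨾ <⇒≤ ω<y₁ ⨾ y₁≤y₂)))
          λ _ w₂≃y₂ → if-cases if₃
            (λ (w₁<α , _) _ → ⊥-elim (<⇒≱ w₁<α (α≤ω ⨾ proj₂ w₁≃ω)))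
            λ _ (z₁≃w₁ , z₂≃w₂) → let z₁≃ω = ≃-trans z₁≃w₁ w₁≃ω
                                      z₂≃y₂ = ≃-trans z₂≃w₂ w₂≃y₂ in k record
              { z₁≤ω  = proj₁ z₁≃ω
              ; α≤z₂  = α≤ω ⨾ <⇒≤ ω<y₁ ⨾ y₁≤y₂ ⨾ proj₂ z₂≃y₂
              ; side  = inj₁ (α≤ω ⨾ proj₂ z₁≃ω)
              ; bound = λ 0≤c o₁≤ω+c _ _ → Step₁.first 0≤c
                  (proj₁ z₁≃ω ⨾ <⇒≤ ω<y₁) (o₁≤ω+c ⨾ +-mono-≤ (proj₂ z₁≃ω) ≤-refl) z₂≃y₂
              })
        λ ω≮y₁ w₁≃y₁ → if-cases if₂
          (λ y₂<α w₂≃α → if-cases if₃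
            (λ (_ , ω<w₂) _ → ⊥-elim (<⇒≱ ω<w₂ (proj₁ w₂≃α ⨾ α≤ω)))
            λ _ (z₁≃w₁ , z₂≃w₂) → let z₁≃y₁ = ≃-trans z₁≃w₁ w₁≃y₁
                                      z₂≃α = ≃-trans z₂≃w₂ w₂≃α in k record
              { z₁≤ω  = proj₁ z₁≃y₁ ⨾ ≮⇒≥ ω≮y₁
              ; α≤z₂  = proj₂ z₂≃α
              ; side  = inj₂ (proj₁ z₂≃α ⨾ α≤ω)
              ; bound = λ 0≤c _ α≤o₂+c _ → Step₁.second 0≤c
                  z₁≃y₁ (<⇒≤ y₂<α ⨾ proj₂ z₂≃α) (proj₁ z₂≃α ⨾ α≤o₂+c)
              })
          λ y₂≮α w₂≃y₂ → if-cases if₃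
            (λ (w₁<α , ω<w₂) (z₁≃ , z₂≃) → squeeze
              (proj₂ w₁≃y₁ ⨾ <⇒≤ w₁<α) (<⇒≤ ω<w₂ ⨾ proj₁ w₂≃y₂)
              (≃-trans z₁≃ (+-congʳ w₁≃y₁)) (≃-trans z₂≃ (-‿congʳ w₂≃y₂)))
            λ ¬outside (z₁≃w₁ , z₂≃w₂) → let z₁≃y₁ = ≃-trans z₁≃w₁ w₁≃y₁
                                             z₂≃y₂ = ≃-trans z₂≃w₂ w₂≃y₂ in
              inside ¬outside z₁≃w₁ z₂≃w₂ λ side → k record
              { z₁≤ω  = proj₁ z₁≃y₁ ⨾ ≮⇒≥ ω≮y₁
              ; α≤z₂  = ≮⇒≥ y₂≮α ⨾ proj₂ z₂≃y₂
              ; side  = side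
              ; bound = λ 0≤c _ _ _ → Step₁.none 0≤c z₁≃y₁ z₂≃y₂
              }
      where
      δ : A
      δ = ∣ y₁ - α ∣ ⊓ ∣ y₂ - ω ∣

      -- A negated conjunction gives a disjunction only classically. Under the assumption that the
      -- goal fails, the second alternative is refuted, and this yields the first.
      inside : ¬ (w₁ < α × ω < w₂) → z₁ ≃ w₁ → z₂ ≃ w₂ →
        (α ≤ z₁ ⊎ z₂ ≤ ω → u ≤ v) → u ≤ v
      inside ¬outside z₁≃w₁ z₂≃w₂ k = ≤-stable λ ≰ →
        ≰ (k (inj₁ (≮⇒≥ (λ w₁<α → ≰ (k (inj₂ (proj₁ z₂≃w₂ ⨾
          ≮⇒≥ (λ ω<w₂ → ¬outside (w₁<α , ω<w₂)))))) ⨾ proj₂ z₁≃w₁)))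

      -- As δ is the smaller distance, the facility attaining it reaches its end agent, which gives
      -- `side`, and neither facility passes its end agent.
      squeeze : y₁ ≤ α → ω ≤ y₂ → z₁ ≃ (y₁ + δ) → z₂ ≃ (y₂ - δ) → u ≤ v
      squeeze y₁≤α ω≤y₂ (z₁≤ , ≤z₁) (z₂≤ , ≤z₂) = ≤-cases ∣ y₁ - α ∣ ∣ y₂ - ω ∣
        (λ d₁≤d₂ → finish (inj₁ (
          prove 5 (λ y α z d δ → α :- y :≤ d :⇒ d :≤ δ :⇒ y :+ δ :≤ z :⇒ α :≤ z)
            (y₁ ∷ α ∷ z₁ ∷ ∣ y₁ - α ∣ ∷ δ ∷ [])
            (y-x≤∣x-y∣ y₁ α) (⊓-glb ≤-refl d₁≤d₂) ≤z₁)))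
        (λ d₂≤d₁ → finish (inj₂ (
          prove 5 (λ y ω z d δ → y :- ω :≤ d :⇒ d :≤ δ :⇒ z :≤ y :- δ :⇒ z :≤ ω)
            (y₂ ∷ ω ∷ z₂ ∷ ∣ y₂ - ω ∣ ∷ δ ∷ [])
            (x-y≤∣x-y∣ y₂ ω) (⊓-glb d₂≤d₁ ≤-refl) z₂≤)))
        where
        0≤δ : 0# ≤ δ
        0≤δ = ⊓-glb (0≤∣x-y∣ y₁ α) (0≤∣x-y∣ y₂ ω)

        z₁≤α : z₁ ≤ α
        z₁≤α = prove 4 (λ y α z δ → z :≤ y :+ δ :⇒ δ :≤ α :- y :⇒ z :≤ α)
          (y₁ ∷ α ∷ z₁ ∷ δ ∷ []) z₁≤ (x⊓y≤x _ _ ⨾ moved-left y₁≤α)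

        ω≤z₂ : ω ≤ z₂
        ω≤z₂ = prove 4 (λ y ω z δ → y :- δ :≤ z :⇒ δ :≤ y :- ω :⇒ ω :≤ z)
          (y₂ ∷ ω ∷ z₂ ∷ δ ∷ []) ≤z₂ (x⊓y≤y _ _ ⨾ moved-right ω≤y₂)

        y₁≤z₁ : y₁ ≤ z₁
        y₁≤z₁ = prove 3 (λ y z δ → :0 :≤ δ :⇒ y :+ δ :≤ z :⇒ y :≤ z) (y₁ ∷ z₁ ∷ δ ∷ []) 0≤δ ≤z₁

        z₂≤y₂ : z₂ ≤ y₂
        z₂≤y₂ = prove 3 (λ y z δ → :0 :≤ δ :⇒ z :≤ y :- δ :⇒ z :≤ y) (y₂ ∷ z₂ ∷ δ ∷ []) 0≤δ z₂≤

        balance : (z₁ + z₂) ≃ (y₁ + y₂)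
        balance =
          prove 5 (λ y₁ y₂ z₁ z₂ δ → z₁ :≤ y₁ :+ δ :⇒ z₂ :≤ y₂ :- δ :⇒ z₁ :+ z₂ :≤ y₁ :+ y₂)
            ρ z₁≤ z₂≤ ,
          prove 5 (λ y₁ y₂ z₁ z₂ δ → y₁ :+ δ :≤ z₁ :⇒ y₂ :- δ :≤ z₂ :⇒ y₁ :+ y₂ :≤ z₁ :+ z₂)
            ρ ≤z₁ ≤z₂
          where
          ρ : Vec A 5
          ρ = y₁ ∷ y₂ ∷ z₁ ∷ z₂ ∷ δ ∷ []

        finish : α ≤ z₁ ⊎ z₂ ≤ ω → u ≤ v
        finish side = k record
          { z₁≤ω  = z₁≤α ⨾ α≤ω
          ; α≤z₂  = α≤ω ⨾ ω≤z₂
          ; side  = side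
          ; bound = λ
            { 0≤c _ _ (inj₁ o₂≤ω+c) → Step₁.both-second 0≤c y₁≤z₁ z₂≤y₂ (proj₁ balance)
                (o₂≤ω+c ⨾ +-mono-≤ ω≤z₂ ≤-refl)
            ; 0≤c _ _ (inj₂ α≤o₁+c) → Step₁.both-first 0≤c y₁≤z₁ z₂≤y₂ (proj₂ balance)
                (z₁≤α ⨾ α≤o₁+c) }
          }

    -- Either facility serving the agent at α satisfies the hypotheses of bound.
    bound₁ : ∀ {D y₁ y₂ z₁ z₂ o₁ o₂} → AfterStep₁ y₁ y₂ z₁ z₂ → o₁ ≤ o₂ →
      (∣ α - o₁ ∣ ⊓ ∣ α - o₂ ∣) ≤ cost₂ D o₁ o₂ →
      (dist (y₁ , y₂) (z₁ , z₂) + potential (o₁ , o₂) (z₁ , z₂)) ≤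
      (potential (o₁ , o₂) (y₁ , y₂) + (4 · cost₂ D o₁ o₂))
    bound₁ {D} {y₁} {y₂} {z₁} {z₂} {o₁} {o₂} after o₁≤o₂ served =
      ≤-cases ∣ α - o₁ ∣ ∣ α - o₂ ∣
        (λ le → by₁ (⊓-glb ≤-refl le ⨾ served))
        (λ ge → by₂ (⊓-glb ge ≤-refl ⨾ served))
      where
      open AfterStep₁ after using (bound)
      c : A
      c = cost₂ D o₁ o₂
      above : ∀ {o} → ∣ α - o ∣ ≤ c → o ≤ (ω + c)
      above {o} = prove 5 (λ α ω o c d → α :≤ ω :⇒ o :- α :≤ d :⇒ d :≤ c :⇒ o :≤ ω :+ c)
        (α ∷ ω ∷ o ∷ c ∷ ∣ α - o ∣ ∷ []) α≤ω (y-x≤∣x-y∣ α o)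
      below : ∀ {o} → ∣ α - o ∣ ≤ c → α ≤ (o + c)
      below {o} = prove 4 (λ α o c d → α :- o :≤ d :⇒ d :≤ c :⇒ α :≤ o :+ c)
        (α ∷ o ∷ c ∷ ∣ α - o ∣ ∷ []) (x-y≤∣x-y∣ α o)
      by₁ : ∣ α - o₁ ∣ ≤ c → (dist (y₁ , y₂) (z₁ , z₂) + potential (o₁ , o₂) (z₁ , z₂)) ≤
        (potential (o₁ , o₂) (y₁ , y₂) + (4 · c))
      by₁ near = bound (cost₂≥0 D o₁ o₂) (above near)
        (below near ⨾ +-mono-≤ o₁≤o₂ ≤-refl) (inj₂ (below near))
      by₂ : ∣ α - o₂ ∣ ≤ c → (dist (y₁ , y₂) (z₁ , z₂) + potential (o₁ , o₂) (z₁ , z₂)) ≤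
        (potential (o₁ , o₂) (y₁ , y₂) + (4 · c))
      by₂ near = bound (cost₂≥0 D o₁ o₂) (o₁≤o₂ ⨾ above near) (below near) (inj₁ (above near))

-- Analysis of Step 2, and of a whole stage

module SecondStep
  {A : Set} {_≤_ : A → A → Set}
  {_+_ _-_ : A → A → A} {0# : A} { -_ ∣_∣ : A → A} {_⊓_ : A → A → A}
  (isOrderedGroup : IsOrderedGroup _≤_ _+_ _-_ 0# (-_) ∣_∣ _⊓_)
  (_<_ : A → A → Set) (<⇒≱ : ∀ {x y} → x < y → ¬ (y ≤ x)) (≮⇒≥ : ∀ {x y} → ¬ (x < y) → y ≤ x)
  (H : List A → A) (_MedianOf_ : A → List A → Set)
  (H-minimal : ∀ {D} → AllPairs _≤_ D → ∀ p → H D ≤ Facilities.cost isOrderedGroup D p)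
  (median-attains : ∀ {D x} → AllPairs _≤_ D → x MedianOf D →
    Facilities.cost isOrderedGroup D x ≤ H D)
  (median-exists : ∀ {D} → AllPairs _≤_ D → ∃ (_MedianOf D))
  (≤median : ∀ {α E x} → AllPairs _≤_ (α ∷ E) → x MedianOf (α ∷ E) → α ≤ x)
  (median≤ : ∀ {α E x} → AllPairs _≤_ (α ∷ E) → x MedianOf (α ∷ E) →
    x ≤ Facilities.lastOf isOrderedGroup α E)
  where

  open OrderedGroup isOrderedGroup
  open Facilities isOrderedGroup
  open Amortization isOrderedGroup
  open FirstStep isOrderedGroup _<_ <⇒≱ ≮⇒≥

  private
    infixr 5 _⨾_
    _⨾_ : ∀ {x y z} → x ≤ y → y ≤ z → x ≤ z
    _⨾_ = ≤-trans

    x≤x+y : ∀ {x y} → 0# ≤ y → x ≤ (x + y)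
    x≤x+y {x} {y} = prove 2 (λ x y → :0 :≤ y :⇒ x :≤ x :+ y) (x ∷ y ∷ [])

    x≤y+x : ∀ {x y} → 0# ≤ y → x ≤ (y + x)
    x≤y+x {x} {y} = prove 2 (λ x y → :0 :≤ y :⇒ x :≤ y :+ x) (x ∷ y ∷ [])

  ≰⇒≥ : ∀ {x y} → ¬ (x ≤ y) → y ≤ x
  ≰⇒≥ {x} {y} x≰y = ≤-cases x y (⊥-elim ∘ x≰y) (λ y≤x → y≤x)

  IsOptimalPartition : List A → List A → List A → Set
  IsOptimalPartition C O₁ O₂ = O₁ ++ O₂ ≡ C ×
    (∀ P₁ P₂ → P₁ ++ P₂ ≡ C → (H O₁ + H O₂) ≤ (H P₁ + H P₂))

  Step₂ᵃ Step₂ᵇ : (α ω : A) (C : List A) → A × A → Set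
  Step₂ᵃ α ω C (z₁ , z₂) = (α ≤ z₁ × z₁ ≤ ω) × ((3 · H C) ≤ (z₂ - ω))
  Step₂ᵇ α ω C (z₁ , z₂) = (α ≤ z₂ × z₂ ≤ ω) × ((3 · H C) ≤ (α - z₁))

  Step₂ : (α ω : A) (C : List A) → A × A → A × A → Set
  Step₂ α ω C z@(z₁ , z₂) (x₁ , x₂) =
    If Step₂ᵃ α ω C z Then x₁ MedianOf C × x₂ ≃ (z₂ - (3 · H C)) Else
    If Step₂ᵇ α ω C z Then x₁ ≃ (z₁ + (3 · H C)) × x₂ MedianOf C Else
    ∃[ O₁ ] ∃[ O₂ ] IsOptimalPartition C O₁ O₂ × x₁ MedianOf O₁ × x₂ MedianOf O₂

  H≥0 : ∀ {D} → AllPairs _≤_ D → 0# ≤ H D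
  H≥0 {D} sorted = let m , med = median-exists sorted in
    cost≥0 D m ⨾ median-attains sorted med

  ++⁻ : ∀ P {Q} → AllPairs _≤_ (P ++ Q) →
    AllPairs _≤_ P × AllPairs _≤_ Q × All (λ β → All (β ≤_) Q) P
  ++⁻ []      sorted        = [] , sorted , []
  ++⁻ (β ∷ P) (β≤ ∷ sorted) =
    let sortedP , sortedQ , P≤Q = ++⁻ P sorted
    in (Allₚ.++⁻ˡ P β≤ ∷ sortedP) , sortedQ , (Allₚ.++⁻ʳ P β≤ ∷ P≤Q)

  -- Cutting the agents at the midpoint of `p` and `q` gives a competing partition, and for each
  -- part a median is at least as good as `p` or `q`.
  partition-cost : ∀ {C O₁ O₂ p q} → AllPairs _≤_ C → IsOptimalPartition C O₁ O₂ →
    p ≤ q → (H O₁ + H O₂) ≤ cost₂ C p q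
  partition-cost {C} sorted (_ , minimal) p≤q = cost₂-split sorted p≤q λ { P Q refl le →
    let sortedP , sortedQ , _ = ++⁻ P sorted in
    minimal P Q refl ⨾ +-mono-≤ (H-minimal sortedP _) (H-minimal sortedQ _) ⨾ le }

  -- Otherwise one facility at β and another one at m would be better than m alone.
  collapse : ∀ {C O₁ O₂ m} → AllPairs _≤_ C → IsOptimalPartition C O₁ O₂ →
    cost C m ≤ (H O₁ + H O₂) → ∀ {β} → β ∈ C → ∣ β - m ∣ ≤ 0#
  collapse {C} {O₁} {O₂} {m} sorted opt le {β} β∈C = ≤-cases β m
    (λ β≤m → conclude (le ⨾ partition-cost sorted opt β≤m))
    (λ m≤β → conclude (le ⨾ partition-cost sorted opt m≤β ⨾ cost₂-comm C m β))
    where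
    conclude : cost C m ≤ cost₂ C β m → ∣ β - m ∣ ≤ 0#
    conclude = prove 3 (λ d c e → d :+ c :≤ e :⇒ e :≤ c :⇒ d :≤ :0)
      (∣ β - m ∣ ∷ cost₂ C β m ∷ cost C m ∷ []) (cost₂-saves m β∈C)

  module _ {α E} (sorted : AllPairs _≤_ (α ∷ E)) where

    private
      C : List A
      C = α ∷ E
      ω h : A
      ω = lastOf α E
      h = H C

    α≤ω : α ≤ ω
    α≤ω = ≤lastOf sorted (here refl)

    0≤h : 0# ≤ h
    0≤h = H≥0 sorted

    spread≤H : (ω - α) ≤ h
    spread≤H = let m , med = median-exists sorted in
      spread≤cost α E m ⨾ median-attains sorted med

    Bound₂ : A × A → A × A → Set
    Bound₂ z x@(x₁ , x₂) = ∀ {o₁ o₂} → o₁ ≤ o₂ →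
      (dist z x + potential (o₁ , o₂) x) ≤
      (potential (o₁ , o₂) z + ((59 · cost₂ C o₁ o₂) - cost₂ C x₁ x₂))

    -- Serves to exclude empty parts in case (c). By `side` one facility is at the common position
    -- of the agents, and as 3H(C) vanishes, the other one only has to be on the proper side of it.
    one-point⇒Step₂ᵃ⊎ᵇ : ∀ {y₁ y₂ z₁ z₂} → AfterStep₁ α≤ω y₁ y₂ z₁ z₂ →
      ω ≤ α → h ≤ 0# → Step₂ᵃ α ω C (z₁ , z₂) ⊎ Step₂ᵇ α ω C (z₁ , z₂)
    one-point⇒Step₂ᵃ⊎ᵇ {z₁ = z₁} {z₂} after ω≤α h≤0 with AfterStep₁.side after
    ... | inj₁ α≤z₁ = inj₁ ((α≤z₁ , AfterStep₁.z₁≤ω after) ,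
      prove 3 (λ h z ω → h :≤ :0 :⇒ ω :≤ z :⇒ 3 :· h :≤ z :- ω) (h ∷ z₂ ∷ ω ∷ [])
        h≤0 (ω≤α ⨾ AfterStep₁.α≤z₂ after))
    ... | inj₂ z₂≤ω = inj₂ ((AfterStep₁.α≤z₂ after , z₂≤ω) ,
      prove 3 (λ h z α → h :≤ :0 :⇒ z :≤ α :⇒ 3 :· h :≤ α :- z) (h ∷ z₁ ∷ α ∷ [])
        h≤0 (AfterStep₁.z₁≤ω after ⨾ ω≤α))

    unsplit⇒one-point : ∀ {O₁ O₂} → IsOptimalPartition C O₁ O₂ → h ≤ (H O₁ + H O₂) →
      ω ≤ α × h ≤ 0#
    unsplit⇒one-point opt le =
      prove 5 (λ α ω m d e → m :- α :≤ d :⇒ ω :- m :≤ e :⇒ d :≤ :0 :⇒ e :≤ :0 :⇒ ω :≤ α)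
        (α ∷ ω ∷ m ∷ ∣ α - m ∣ ∷ ∣ ω - m ∣ ∷ [])
        (y-x≤∣x-y∣ α m) (x-y≤∣x-y∣ ω m) (at-m (here refl)) (at-m (lastOf-∈ α E)) ,
      (H-minimal sorted m ⨾ cost≤0 (All.tabulate at-m))
      where
      m : A
      m = proj₁ (median-exists sorted)
      at-m : ∀ {β} → β ∈ C → ∣ β - m ∣ ≤ 0#
      at-m = collapse sorted opt (median-attains sorted (proj₂ (median-exists sorted)) ⨾ le)
      cost≤0 : ∀ {D} → All (λ β → ∣ β - m ∣ ≤ 0#) D → cost D m ≤ 0#
      cost≤0 []         = ≤-refl
      cost≤0 (le ∷ les) = +-mono-≤ le (cost≤0 les) ⨾ proj₁ (identityˡ 0#)

    -- The facility singled out by `side` is between the end agents, so that (a) or (b) can only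
    -- have failed because the other facility is too near.
    outside-bounds : ∀ {y₁ y₂ z₁ z₂} → AfterStep₁ α≤ω y₁ y₂ z₁ z₂ →
      ¬ Step₂ᵃ α ω C (z₁ , z₂) → ¬ Step₂ᵇ α ω C (z₁ , z₂) →
      ((α - z₁) ≤ (3 · h)) × ((z₂ - ω) ≤ (3 · h))
    outside-bounds {z₁ = z₁} {z₂} after ¬a ¬b with AfterStep₁.side after
    ... | inj₁ α≤z₁ =
      prove 3 (λ h z α → :0 :≤ h :⇒ α :≤ z :⇒ α :- z :≤ 3 :· h) (h ∷ z₁ ∷ α ∷ []) 0≤h α≤z₁ ,
      ≰⇒≥ (λ le → ¬a ((α≤z₁ , AfterStep₁.z₁≤ω after) , le))
    ... | inj₂ z₂≤ω =
      ≰⇒≥ (λ le → ¬b ((AfterStep₁.α≤z₂ after , z₂≤ω) , le)) ,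
      prove 3 (λ h z ω → :0 :≤ h :⇒ z :≤ ω :⇒ z :- ω :≤ 3 :· h) (h ∷ z₂ ∷ ω ∷ []) 0≤h z₂≤ω

    step₂ : ∀ {y₁ y₂ z₁ z₂ x₁ x₂ u v} → AfterStep₁ α≤ω y₁ y₂ z₁ z₂ →
      Step₂ α ω C (z₁ , z₂) (x₁ , x₂) →
      (x₁ ≤ x₂ → Bound₂ (z₁ , z₂) (x₁ , x₂) → u ≤ v) → u ≤ v
    step₂ {z₁ = z₁} {z₂} {x₁} {x₂} {u} {v} after if₁ k = if-cases if₁
      (λ { ((α≤z₁ , z₁≤ω) , far) (med , x₂≃) → k
        (median≤ sorted med ⨾
          -- Retreating by 3H(C) does not carry the facility past ω, so the order is preserved.
          prove 4 (λ ω h z x → 3 :· h :≤ z :- ω :⇒ z :- 3 :· h :≤ x :⇒ ω :≤ x)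
            (ω ∷ h ∷ z₂ ∷ x₂ ∷ []) far (proj₂ x₂≃))
        λ {o₁} {o₂} o₁≤o₂ → by-dichotomy o₁≤o₂ λ dich → Amortization.Step₂.caseᵃ isOrderedGroup
          (cost₂≥0 C o₁ o₂) dich (cost₂≤cost₁ C x₁ x₂ ⨾ median-attains sorted med)
          0≤h spread≤H α≤z₁ z₁≤ω (≤median sorted med) (median≤ sorted med) far x₂≃ })
      λ ¬a if₂ → if-cases if₂
      (λ { ((α≤z₂ , z₂≤ω) , far) (x₁≃ , med) → k
        (prove 4 (λ α h z x → 3 :· h :≤ α :- z :⇒ x :≤ z :+ 3 :· h :⇒ x :≤ α)
          (α ∷ h ∷ z₁ ∷ x₁ ∷ []) far (proj₁ x₁≃) ⨾ ≤median sorted med)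
        λ {o₁} {o₂} o₁≤o₂ → by-dichotomy o₁≤o₂ λ dich → Amortization.Step₂.caseᵇ isOrderedGroup
          (cost₂≥0 C o₁ o₂) dich
          (cost₂-comm C x₁ x₂ ⨾ cost₂≤cost₁ C x₂ x₁ ⨾ median-attains sorted med)
          0≤h spread≤H α≤z₂ z₂≤ω (≤median sorted med) (median≤ sorted med) far x₁≃ })
      λ { ¬b (O₁ , O₂ , opt , med₁ , med₂) → split ¬a ¬b O₁ O₂ opt med₁ med₂ }
      where
      by-dichotomy : ∀ {o₁ o₂ u v} → o₁ ≤ o₂ →
        ((h ≤ cost₂ C o₁ o₂) ⊎ (∣ α - o₁ ∣ ≤ cost₂ C o₁ o₂) × (∣ ω - o₂ ∣ ≤ cost₂ C o₁ o₂) →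
          u ≤ v) → u ≤ v
      by-dichotomy o₁≤o₂ k = one-or-two sorted o₁≤o₂ (H-minimal sorted)
        (k ∘ inj₁) (λ αo ωo → k (inj₂ (αo , ωo)))

      split : ¬ Step₂ᵃ α ω C (z₁ , z₂) → ¬ Step₂ᵇ α ω C (z₁ , z₂) →
        ∀ O₁ O₂ → IsOptimalPartition C O₁ O₂ → x₁ MedianOf O₁ → x₂ MedianOf O₂ → u ≤ v
      split ¬a ¬b [] O₂ opt@(refl , _) _ _ = ⊥-elim ([ ¬a , ¬b ]′
        (one-point⇒Step₂ᵃ⊎ᵇ after (proj₁ one) (proj₂ one)))
        where one = unsplit⇒one-point opt (x≤y+x (H≥0 []))
      split ¬a ¬b O₁@(_ ∷ _) [] opt@(eq , _) _ _ = ⊥-elim ([ ¬a , ¬b ]′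
        (one-point⇒Step₂ᵃ⊎ᵇ after (proj₁ one) (proj₂ one)))
        where
        one = unsplit⇒one-point opt
          (subst (λ D → h ≤ (H D + H [])) (trans (sym eq) (++-identityʳ O₁)) (x≤x+y (H≥0 [])))
      split ¬a ¬b (α ∷ P) (β ∷ Q) opt@(refl , _) med₁ med₂ = k x₁≤x₂ bound
        where
        O₁ O₂ : List A
        O₁ = α ∷ P
        O₂ = β ∷ Q
        sorted₁ : AllPairs _≤_ O₁
        sorted₁ = proj₁ (++⁻ O₁ sorted)
        sorted₂ : AllPairs _≤_ O₂
        sorted₂ = proj₁ (proj₂ (++⁻ O₁ sorted))
        x₁≤x₂ : x₁ ≤ x₂
        x₁≤x₂ = median≤ sorted₁ med₁ ⨾
          All.head (All.lookup (proj₂ (proj₂ (++⁻ O₁ sorted))) (lastOf-∈ α P)) ⨾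
          ≤median sorted₂ med₂
        α≤x₁ : α ≤ x₁
        α≤x₁ = ≤median sorted₁ med₁
        x₂≤ω : x₂ ≤ ω
        x₂≤ω = subst (x₂ ≤_) (sym (lastOf-++ α P β Q)) (median≤ sorted₂ med₂)
        bound : Bound₂ (z₁ , z₂) (x₁ , x₂)
        bound {o₁} {o₂} o₁≤o₂ = by-dichotomy o₁≤o₂ λ dich →
          Amortization.Step₂.caseᶜ isOrderedGroup (cost₂≥0 C o₁ o₂) dich
            (cost₂-++ O₁ O₂ x₁ x₂ ⨾
              +-mono-≤ (median-attains sorted₁ med₁) (median-attains sorted₂ med₂) ⨾ total≤c)
            0≤h spread≤H (AfterStep₁.z₁≤ω after) (AfterStep₁.α≤z₂ after)
            (proj₁ (outside-bounds after ¬a ¬b)) (proj₂ (outside-bounds after ¬a ¬b))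
            α≤x₁ (x₁≤x₂ ⨾ x₂≤ω) (α≤x₁ ⨾ x₁≤x₂) x₂≤ω
            -- The end agents belong to different parts, so their distances to `x₁` and `x₂` are at
            -- most H(O₁) and H(O₂), hence at most the total.
            (cost-∈ {O₁} x₁ (here refl) ⨾ median-attains sorted₁ med₁ ⨾
              x≤x+y (H≥0 sorted₂) ⨾ total≤c)
            (subst (λ ω → ∣ ω - x₂ ∣ ≤ cost₂ C o₁ o₂) (sym (lastOf-++ α P β Q))
              (cost-∈ x₂ (lastOf-∈ β Q) ⨾ median-attains sorted₂ med₂ ⨾
                x≤y+x (H≥0 sorted₁) ⨾ total≤c))
          where
          total≤c : (H O₁ + H O₂) ≤ cost₂ C o₁ o₂
          total≤c = partition-cost sorted opt o₁≤o₂

  stage : ∀ {α ω C E y₁ y₂ w₁ w₂ z₁ z₂ x₁ x₂ u v} → let δ = ∣ y₁ - α ∣ ⊓ ∣ y₂ - ω ∣ in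
    C ≡ α ∷ E → ω ≡ lastOf α E → AllPairs _≤_ C → y₁ ≤ y₂ →
    (If ω < y₁ Then w₁ ≃ ω Else w₁ ≃ y₁) →
    (If y₂ < α Then w₂ ≃ α Else w₂ ≃ y₂) →
    (If w₁ < α × ω < w₂ Then z₁ ≃ (w₁ + δ) × z₂ ≃ (w₂ - δ) Else z₁ ≃ w₁ × z₂ ≃ w₂) →
    Step₂ α ω C (z₁ , z₂) (x₁ , x₂) →
    (x₁ ≤ x₂ →
      (∀ o → ((dist (y₁ , y₂) (x₁ , x₂) + cost₂ C x₁ x₂) + symmetricPotential o (x₁ , x₂)) ≤
             (symmetricPotential o (y₁ , y₂) + (63 · cost₂ C (proj₁ o) (proj₂ o)))) →
      u ≤ v) → u ≤ v
  stage {C = C} {E = E} refl refl sorted y₁≤y₂ if₁ if₂ if₃ alg₂ k =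
    step₁ (α≤ω sorted) y₁≤y₂ if₁ if₂ if₃ λ after →
    step₂ sorted after alg₂ λ x₁≤x₂ bound → k x₁≤x₂
      (amortized {C} y₁≤y₂ λ {o₁} {o₂} o₁≤o₂ → two-steps
        (bound₁ (α≤ω sorted) {C} after o₁≤o₂ (x≤x+y (cost₂≥0 E o₁ o₂)))
        (bound o₁≤o₂))

-- The Cauchy reals as an ordered group

open import Defs

module RealNumbers where

  open +-*-Solver

  private
    ⅕ : ℚ
    ⅕ = + 1 ℚ./ 5

    fifth-pos : ∀ {ε} → 0ℚ ℚ.< ε → 0ℚ ℚ.< ⅕ ℚ.* ε
    fifth-pos {ε} 0<ε = subst (ℚ._< ⅕ ℚ.* ε) (ℚₚ.*-zeroʳ ⅕) (ℚₚ.*-monoʳ-<-pos ⅕ 0<ε)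

    half-pos : ∀ {ε} → 0ℚ ℚ.< ε → 0ℚ ℚ.< ½ ℚ.* ε
    half-pos {ε} 0<ε = subst (ℚ._< ½ ℚ.* ε) (ℚₚ.*-zeroʳ ½) (ℚₚ.*-monoʳ-<-pos ½ 0<ε)

    p≤∣p∣ : ∀ p → p ℚ.≤ ℚ.∣ p ∣
    p≤∣p∣ p with ℚₚ.≤-total 0ℚ p
    ... | inj₁ 0≤p = ℚₚ.≤-reflexive (sym (ℚₚ.0≤p⇒∣p∣≡p 0≤p))
    ... | inj₂ p≤0 = ℚₚ.≤-trans p≤0 (ℚₚ.0≤∣p∣ p)

    near : ∀ {p q ε} → ℚ.∣ p ℚ.- q ∣ ℚ.≤ ε → p ℚ.≤ q ℚ.+ ε
    near {p} {q} le = subst (ℚ._≤ q ℚ.+ _)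
      (solve 2 (λ p q → q :+ (p :- q) := p) refl p q)
      (ℚₚ.+-monoʳ-≤ q (ℚₚ.≤-trans (p≤∣p∣ (p ℚ.- q)) le))

    p≤p+ε : ∀ p {ε} → 0ℚ ℚ.< ε → p ℚ.≤ p ℚ.+ ε
    p≤p+ε p {ε} 0<ε = subst (ℚ._≤ p ℚ.+ ε) (ℚₚ.+-identityʳ p) (ℚₚ.+-monoʳ-≤ p (ℚₚ.<⇒≤ 0<ε))

  pointwise : ∀ {x y} → (∀ n → seq x n ℚ.≤ seq y n) → x ≤ y
  pointwise le ε 0<ε = 0 , λ n _ → ℚₚ.≤-trans (le n) (p≤p+ε _ 0<ε)

  pointwise-≃ : ∀ {x y} → (∀ n → seq x n ≡ seq y n) → x ≃ y
  pointwise-≃ {x} {y} eq = pointwise {x} {y} (ℚₚ.≤-reflexive ∘ eq) ,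
                           pointwise {y} {x} (ℚₚ.≤-reflexive ∘ sym ∘ eq)

  trans-≤ : ∀ {x y z} → x ≤ y → y ≤ z → x ≤ z
  trans-≤ {x} {y} {z} p q ε 0<ε =
    let M , f = p (½ ℚ.* ε) (half-pos 0<ε)
        N , g = q (½ ℚ.* ε) (half-pos 0<ε)
    in M ℕ.⊔ N , λ n n≥ → ℚₚ.≤-trans (f n (ℕₚ.m⊔n≤o⇒m≤o M N n≥))
         (subst (seq y n ℚ.+ ½ ℚ.* ε ℚ.≤_)
           (solve 2 (λ z ε → (z :+ con ½ :* ε) :+ con ½ :* ε := z :+ ε) refl (seq z n) ε)
           (ℚₚ.+-monoˡ-≤ (½ ℚ.* ε) (g n (ℕₚ.m⊔n≤o⇒n≤o M N n≥))))

  +-monoʳ : ∀ x {y z} → y ≤ z → x + y ≤ x + z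
  +-monoʳ x {y} {z} le ε 0<ε =
    let N , f = le ε 0<ε
    in N , λ n n≥ → subst (seq x n ℚ.+ seq y n ℚ.≤_) (sym (ℚₚ.+-assoc (seq x n) (seq z n) ε))
         (ℚₚ.+-monoʳ-≤ (seq x n) (f n n≥))

  private
    +-cancelˡ-≤ : ∀ r {p q} → r ℚ.+ p ℚ.≤ r ℚ.+ q → p ℚ.≤ q
    +-cancelˡ-≤ r {p} {q} le = subst₂ ℚ._≤_ (undo p) (undo q) (ℚₚ.+-monoʳ-≤ (ℚ.- r) le)
      where
      undo : ∀ p → ℚ.- r ℚ.+ (r ℚ.+ p) ≡ p
      undo = solve 2 (λ r p → :- r :+ (r :+ p) := p) refl r

    +-cancelʳ-≤ : ∀ r {p q} → p ℚ.+ r ℚ.≤ q ℚ.+ r → p ℚ.≤ q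
    +-cancelʳ-≤ r {p} {q} le =
      +-cancelˡ-≤ r (subst₂ ℚ._≤_ (ℚₚ.+-comm p r) (ℚₚ.+-comm q r) le)

  -- Decided by comparing a single late approximation of x with one of y.
  compare : ∀ x y ε → 0ℚ ℚ.< ε →
    (∃[ N ] ∀ n → N ℕ.≤ n → seq x n ℚ.≤ seq y n ℚ.+ ε) ⊎ y < x
  compare x y ε 0<ε = decide (ℚₚ.≤-total (seq x K) (seq y K ℚ.+ (δ ℚ.+ δ ℚ.+ δ)))
    where
    δ : ℚ
    -- The test has margin 3δ. If it succeeds, one δ each for the oscillation of `x` and `y`
    -- completes ε; if it fails, subtracting these two leaves a strict separation by δ.
    δ = ⅕ ℚ.* ε
    0<δ : 0ℚ ℚ.< δ
    0<δ = fifth-pos 0<ε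
    M N K : ℕ
    M = proj₁ (cauchy x δ 0<δ)
    N = proj₁ (cauchy y δ 0<δ)
    K = M ℕ.⊔ N
    near-x : ∀ {m n} → K ℕ.≤ m → K ℕ.≤ n → seq x m ℚ.≤ seq x n ℚ.+ δ
    near-x {m} {n} m≥ n≥ = near {seq x m} {seq x n}
      (proj₂ (cauchy x δ 0<δ) m n (ℕₚ.m⊔n≤o⇒m≤o M N m≥) (ℕₚ.m⊔n≤o⇒m≤o M N n≥))
    near-y : ∀ {m n} → K ℕ.≤ m → K ℕ.≤ n → seq y m ℚ.≤ seq y n ℚ.+ δ
    near-y {m} {n} m≥ n≥ = near {seq y m} {seq y n}
      (proj₂ (cauchy y δ 0<δ) m n (ℕₚ.m⊔n≤o⇒n≤o M N m≥) (ℕₚ.m⊔n≤o⇒n≤o M N n≥))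
    decide : _ → (∃[ N ] ∀ n → N ℕ.≤ n → seq x n ℚ.≤ seq y n ℚ.+ ε) ⊎ y < x
    decide (inj₁ le) = inj₁ (K , λ n n≥ → begin
      seq x n                                  ≤⟨ near-x n≥ ℕₚ.≤-refl ⟩
      seq x K ℚ.+ δ                            ≤⟨ ℚₚ.+-monoˡ-≤ δ le ⟩
      seq y K ℚ.+ (δ ℚ.+ δ ℚ.+ δ) ℚ.+ δ        ≤⟨ ℚₚ.+-monoˡ-≤ δ (ℚₚ.+-monoˡ-≤ (δ ℚ.+ δ ℚ.+ δ)
                                                    (near-y ℕₚ.≤-refl n≥)) ⟩
      seq y n ℚ.+ δ ℚ.+ (δ ℚ.+ δ ℚ.+ δ) ℚ.+ δ  ≡⟨ solve 2 (λ y ε → let d = con ⅕ :* ε in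
                                                    y :+ d :+ (d :+ d :+ d) :+ d := y :+ ε)
                                                    refl (seq y n) ε ⟩
      seq y n ℚ.+ ε                            ∎)
      where open ℚₚ.≤-Reasoning
    decide (inj₂ ge) = inj₂ (δ , 0<δ , K , λ n n≥ → +-cancelʳ-≤ δ (begin
      seq y n ℚ.+ δ ℚ.+ δ          ≤⟨ ℚₚ.+-monoˡ-≤ δ (ℚₚ.+-monoˡ-≤ δ (near-y n≥ ℕₚ.≤-refl)) ⟩
      seq y K ℚ.+ δ ℚ.+ δ ℚ.+ δ    ≡⟨ solve 2 (λ y d → y :+ d :+ d :+ d := y :+ (d :+ d :+ d))
                                     refl (seq y K) δ ⟩
      seq y K ℚ.+ (δ ℚ.+ δ ℚ.+ δ)  ≤⟨ ge ⟩
      seq x K                      ≤⟨ near-x ℕₚ.≤-refl n≥ ⟩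
      seq x n ℚ.+ δ                ∎))
      where open ℚₚ.≤-Reasoning

  <⇒≱ : ∀ {x y} → x < y → ¬ (y ≤ x)
  <⇒≱ {x} {y} (ε , 0<ε , M , f) y≤x =
    let N , g = y≤x (½ ℚ.* ε) (half-pos 0<ε)
        n     = M ℕ.⊔ N
        ε≤½ε  = +-cancelˡ-≤ (seq x n)
                  (ℚₚ.≤-trans (f n (ℕₚ.m≤m⊔n M N)) (g n (ℕₚ.m≤n⊔m M N)))
        ½ε<ε  = subst₂ ℚ._<_ (ℚₚ.+-identityʳ (½ ℚ.* ε))
                  (solve 1 (λ ε → con ½ :* ε :+ con ½ :* ε := ε) refl ε)
                  (ℚₚ.+-monoʳ-< (½ ℚ.* ε) (half-pos 0<ε))
    in ℚₚ.<-irrefl refl (ℚₚ.≤-<-trans ε≤½ε ½ε<ε)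

  ≮⇒≥ : ∀ {x y} → ¬ (x < y) → y ≤ x
  ≮⇒≥ {x} {y} x≮y ε 0<ε = [ (λ le → le) , ⊥-elim ∘ x≮y ]′ (compare y x ε 0<ε)

  stable : ∀ {x y} → ¬ ¬ (x ≤ y) → x ≤ y
  stable {x} {y} ¬¬le = ≮⇒≥ {y} {x} λ y<x → ¬¬le (<⇒≱ {y} {x} y<x)

  total : ∀ x y → ¬ ¬ (x ≤ y ⊎ y ≤ x)
  total x y ¬total =
    ¬total (inj₁ (≮⇒≥ {y} {x} λ y<x → ¬total (inj₂ (<⇒≤ {y} {x} y<x))))
    where
    <⇒≤ : ∀ {x y} → x < y → x ≤ y
    <⇒≤ {x} {y} (δ , 0<δ , N , f) ε 0<ε = N , λ n n≥ →
      ℚₚ.≤-trans (p≤p+ε (seq x n) 0<δ) (ℚₚ.≤-trans (f n n≥) (p≤p+ε (seq y n) 0<ε))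

  +-mono : ∀ {x y u v} → x ≤ y → u ≤ v → x + u ≤ y + v
  +-mono {x} {y} {u} {v} x≤y u≤v = trans-≤ {x + u} {x + v} {y + v}
    (+-monoʳ x {u} {v} u≤v)
    (trans-≤ {x + v} {v + x} {y + v}
      (proj₁ (pointwise-≃ {x + v} {v + x} λ n → ℚₚ.+-comm (seq x n) (seq v n)))
      (trans-≤ {v + x} {v + y} {y + v} (+-monoʳ v {x} {y} x≤y)
        (proj₁ (pointwise-≃ {v + y} {y + v} λ n → ℚₚ.+-comm (seq v n) (seq y n)))))

  neg-antimono : ∀ {x y} → x ≤ y → - y ≤ - x
  neg-antimono {x} {y} le ε 0<ε =
    let N , f = le ε 0<ε
    in N , λ n n≥ → subst (ℚ._≤ ℚ.- seq x n ℚ.+ ε)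
         (solve 2 (λ y ε → :- (y :+ ε) :+ ε := :- y) refl (seq y n) ε)
         (ℚₚ.+-monoˡ-≤ ε (ℚₚ.neg-antimono-≤ (f n n≥)))

  isAbelianGroup : IsAbelianGroup _≃_ _+_ 0ℝ (-_)
  isAbelianGroup = record
    { isGroup = record
      { isMonoid = record
        { isSemigroup = record
          { isMagma = record
            { isEquivalence = record
              { refl  = λ {x} → pointwise-≃ {x} {x} λ _ → refl
              ; sym   = λ (le , ge) → ge , le
              ; trans = λ {x} {y} {z} (le , ge) (le′ , ge′) →
                  trans-≤ {x} {y} {z} le le′ , trans-≤ {z} {y} {x} ge′ ge
              }
            ; ∙-cong = λ {x} {y} {u} {v} (le , ge) (le′ , ge′) →
                +-mono {x} {y} {u} {v} le le′ , +-mono {y} {x} {v} {u} ge ge′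
            }
          ; assoc = λ x y z → pointwise-≃ {x + y + z} {x + (y + z)} λ n →
              ℚₚ.+-assoc (seq x n) (seq y n) (seq z n)
          }
        ; identity = (λ x → pointwise-≃ {0ℝ + x} {x} λ n → ℚₚ.+-identityˡ (seq x n)) ,
                     (λ x → pointwise-≃ {x + 0ℝ} {x} λ n → ℚₚ.+-identityʳ (seq x n))
        }
      ; inverse = (λ x → pointwise-≃ {(- x) + x} {0ℝ} λ n → ℚₚ.+-inverseˡ (seq x n)) ,
                  (λ x → pointwise-≃ {x + (- x)} {0ℝ} λ n → ℚₚ.+-inverseʳ (seq x n))
      ; ⁻¹-cong = λ {x} {y} (le , ge) → neg-antimono {y} {x} ge , neg-antimono {x} {y} le
      }
    ; comm = λ x y → pointwise-≃ {x + y} {y + x} λ n → ℚₚ.+-comm (seq x n) (seq y n)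
    }

  isOrderedGroup : IsOrderedGroup _≤_ _+_ _-_ 0ℝ (-_) ∣_∣ _⊓_
  isOrderedGroup = record
    { ≤-refl         = λ {x} → pointwise {x} {x} λ _ → ℚₚ.≤-refl
    ; ≤-trans        = λ {x} {y} {z} → trans-≤ {x} {y} {z}
    ; ≤-stable       = λ {x} {y} → stable {x} {y}
    ; ≤-total        = total
    ; isAbelianGroup = isAbelianGroup
    ; x-y≃x+-y       = λ x y → pointwise-≃ {x - y} {x - y} λ _ → refl
    ; +-monoʳ-≤      = λ x {y} {z} → +-monoʳ x {y} {z}
    ; x≤∣x∣          = λ x → pointwise {x} {∣ x ∣} λ n → p≤∣p∣ (seq x n)
    ; -x≤∣x∣         = λ x → pointwise { - x} {∣ x ∣} λ n →
        subst (ℚ.- seq x n ℚ.≤_) (ℚₚ.∣-p∣≡∣p∣ (seq x n)) (p≤∣p∣ (ℚ.- seq x n))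
    ; ∣x∣≤y          = λ {x} {y} le ge ε 0<ε →
        let M , f = le ε 0<ε
            N , g = ge ε 0<ε
        in M ℕ.⊔ N , λ n n≥ →
           [ (λ eq → subst (ℚ._≤ seq y n ℚ.+ ε) (sym eq) (f n (ℕₚ.m⊔n≤o⇒m≤o M N n≥)))
           , (λ eq → subst (ℚ._≤ seq y n ℚ.+ ε) (sym eq) (g n (ℕₚ.m⊔n≤o⇒n≤o M N n≥)))
           ]′ (ℚₚ.∣p∣≡p∨∣p∣≡-p (seq x n))
    ; x⊓y≤x          = λ x y → pointwise {x ⊓ y} {x} λ n → ℚₚ.p⊓q≤p (seq x n) (seq y n)
    ; x⊓y≤y          = λ x y → pointwise {x ⊓ y} {y} λ n → ℚₚ.p⊓q≤q (seq x n) (seq y n)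
    ; ⊓-glb          = λ {x} {y} {z} le le′ ε 0<ε →
        let M , f = le ε 0<ε
            N , g = le′ ε 0<ε
        in M ℕ.⊔ N , λ n n≥ → subst (seq z n ℚ.≤_)
             (sym (ℚₚ.mono-≤-distrib-⊓ (ℚₚ.+-monoˡ-≤ ε) (seq x n) (seq y n)))
             (ℚₚ.⊓-glb (f n (ℕₚ.m⊔n≤o⇒m≤o M N n≥)) (g n (ℕₚ.m⊔n≤o⇒n≤o M N n≥)))
    }

-- Medians of lists of reals

private
  module G = OrderedGroup RealNumbers.isOrderedGroup
  module F = Facilities RealNumbers.isOrderedGroup
  module A = Amortization RealNumbers.isOrderedGroup

module Medians where

  private
    lowerIndex upperIndex : ∀ (α : ℝ) E → Fin (length (α ∷ E))
    lowerIndex α E = fromℕ< (s≤s (ℕₚ.⌊n/2⌋≤n (length E)))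
    upperIndex α E = fromℕ< (s≤s (ℕₚ.⌈n/2⌉≤n (length E)))

    ⌈n/2⌉≤1+⌊n/2⌋ : ∀ n → ⌈ n /2⌉ ℕ.≤ suc ⌊ n /2⌋
    -- By definition the two sides are the rounded-down halves of n + 1 and n + 2.
    ⌈n/2⌉≤1+⌊n/2⌋ n = ℕₚ.⌊n/2⌋-mono (ℕₚ.n≤1+n (suc n))

    lowerIndex-large : ∀ α E → length E ∸ toℕ (lowerIndex α E) ℕ.≤ suc (toℕ (lowerIndex α E))
    lowerIndex-large α E
      rewrite Finₚ.toℕ-fromℕ< (s≤s (ℕₚ.⌊n/2⌋≤n (length E))) = begin
      m ∸ ⌊ m /2⌋                     ≡⟨ cong (_∸ ⌊ m /2⌋) (ℕₚ.⌊n/2⌋+⌈n/2⌉≡n m) ⟨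
      ⌊ m /2⌋ ℕ.+ ⌈ m /2⌉ ∸ ⌊ m /2⌋   ≡⟨ ℕₚ.m+n∸m≡n ⌊ m /2⌋ ⌈ m /2⌉ ⟩
      ⌈ m /2⌉                         ≤⟨ ⌈n/2⌉≤1+⌊n/2⌋ m ⟩
      suc ⌊ m /2⌋                     ∎
      where
      open ℕₚ.≤-Reasoning
      m = length E

    upperIndex-small : ∀ α E →
      toℕ (upperIndex α E) ℕ.≤ length (α ∷ E) ∸ toℕ (upperIndex α E)
    upperIndex-small α E
      rewrite Finₚ.toℕ-fromℕ< (s≤s (ℕₚ.⌈n/2⌉≤n (length E))) =
      ℕₚ.m+n≤o⇒m≤o∸n ⌈ m /2⌉ (begin
        ⌈ m /2⌉ ℕ.+ ⌈ m /2⌉       ≤⟨ ℕₚ.+-monoˡ-≤ ⌈ m /2⌉ (⌈n/2⌉≤1+⌊n/2⌋ m) ⟩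
        suc (⌊ m /2⌋ ℕ.+ ⌈ m /2⌉) ≡⟨ cong suc (ℕₚ.⌊n/2⌋+⌈n/2⌉≡n m) ⟩
        suc m                     ∎)
      where
      open ℕₚ.≤-Reasoning
      m = length E

    lower≤upper : ∀ {α E} → AllPairs _≤_ (α ∷ E) → lowerMedian α E ≤ upperMedian α E
    lower≤upper {α} {E} sorted = F.lookup-mono sorted (lowerIndex α E) (upperIndex α E)
      (subst₂ ℕ._≤_ (sym (Finₚ.toℕ-fromℕ< _)) (sym (Finₚ.toℕ-fromℕ< _)) (ℕₚ.⌊n/2⌋≤⌈n/2⌉ (length E)))

    minimal : ∀ {α E x} → AllPairs _≤_ (α ∷ E) → x PlacedAtMedianOf (α ∷ E) →
      ∀ p → F.cost (α ∷ E) x ≤ F.cost (α ∷ E) p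
    minimal {α} {E} {x} sorted (lower≤x , x≤upper) =
      F.median-minimal {α ∷ E} {x} sorted (lowerIndex α E) (upperIndex α E)
        (lowerIndex-large α E) (upperIndex-small α E) lower≤x x≤upper

  lowerMedian-placed : ∀ {α E} → AllPairs _≤_ (α ∷ E) →
    lowerMedian α E PlacedAtMedianOf (α ∷ E)
  lowerMedian-placed {α} {E} sorted = G.≤-refl {lowerMedian α E} , lower≤upper sorted

  private
    distances : List ℝ → ℝ → ℝ
    distances D p = sum (List.map (λ β → ∣ β - p ∣) D)

    -- For a variable D these are conversions; at a cons, unfolding both sides
    -- down to the Cauchy sequences would be infeasible.
    distances≤cost : ∀ D p → distances D p ≤ F.cost D p
    distances≤cost D p = G.≤-refl {distances D p}

    cost≤distances : ∀ D p → F.cost D p ≤ distances D p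
    cost≤distances D p = G.≤-refl {distances D p}

  H-minimal : ∀ {D} → AllPairs _≤_ D → ∀ p → H D ≤ F.cost D p
  H-minimal {[]}    _      p = G.≤-refl {0ℝ}
  H-minimal {α ∷ E} sorted p =
    G.≤-trans {distances (α ∷ E) (lowerMedian α E)} {F.cost (α ∷ E) (lowerMedian α E)}
      {F.cost (α ∷ E) p}
      (distances≤cost (α ∷ E) (lowerMedian α E))
      (minimal {α} {E} {lowerMedian α E} sorted (lowerMedian-placed sorted) p)

  median-attains : ∀ {D x} → AllPairs _≤_ D → x PlacedAtMedianOf D → F.cost D x ≤ H D
  median-attains {[]}        _      _      = G.≤-refl {0ℝ}
  median-attains {α ∷ E} {x} sorted placed =
    G.≤-trans {F.cost (α ∷ E) x} {F.cost (α ∷ E) (lowerMedian α E)}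
      {distances (α ∷ E) (lowerMedian α E)}
      (minimal {α} {E} {x} sorted placed (lowerMedian α E))
      (cost≤distances (α ∷ E) (lowerMedian α E))

  median-exists : ∀ {D} → AllPairs _≤_ D → ∃ (_PlacedAtMedianOf D)
  median-exists {[]}    _      = 0ℝ , _
  median-exists {α ∷ E} sorted = lowerMedian α E , lowerMedian-placed sorted

  ≤median : ∀ {α E x} → AllPairs _≤_ (α ∷ E) → x PlacedAtMedianOf (α ∷ E) → α ≤ x
  ≤median {α} {E} {x} sorted (lower≤x , _) = G.≤-trans {α} {lowerMedian α E} {x}
    (F.head≤ sorted (∈-lookup (lowerIndex α E))) lower≤x

  median≤ : ∀ {α E x} → AllPairs _≤_ (α ∷ E) → x PlacedAtMedianOf (α ∷ E) → x ≤ F.lastOf α E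
  median≤ {α} {E} {x} sorted (_ , x≤upper) = G.≤-trans {x} {upperMedian α E} {F.lastOf α E}
    x≤upper (F.≤lastOf sorted (∈-lookup (upperIndex α E)))

-- Summation over the stages of an instance

private
  module S = SecondStep RealNumbers.isOrderedGroup
    _<_ (λ {x} {y} → RealNumbers.<⇒≱ {x} {y}) (λ {x} {y} → RealNumbers.≮⇒≥ {x} {y})
    H _PlacedAtMedianOf_ Medians.H-minimal
    (λ {D} {x} → Medians.median-attains {D} {x}) Medians.median-exists
    (λ {α} {E} {x} → Medians.≤median {α} {E} {x}) (λ {α} {E} {x} → Medians.median≤ {α} {E} {x})

sorted-toList : ∀ {n} {C : Vec ℝ n} → Linked _≤_ C → AllPairs _≤_ (toList C)
sorted-toList []        = []
sorted-toList [-]       = [] ∷ []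
sorted-toList {C = α ∷ C} (α≤ ∷ sorted) =
  VecAllₚ.toList⁺ {P = α ≤_}
    (Linked⇒All {R = _≤_} (λ {x} {y} {z} → G.≤-trans {x} {y} {z}) {v = α} {xs = C} α≤ sorted) ∷
  sorted-toList sorted

toList-∷ : ∀ {n} (C : Vec ℝ (suc n)) → toList C ≡ Vec.head C ∷ toList (Vec.tail C)
toList-∷ (α ∷ E) = refl

last-toList : ∀ {n} (C : Vec ℝ (suc n)) →
  Vec.last C ≡ F.lastOf (Vec.head C) (toList (Vec.tail C))
last-toList (α ∷ [])    = refl
last-toList (α ∷ β ∷ E) = last-toList (β ∷ E)

stage : ∀ {n} (C : Vec ℝ (suc n)) (y x : ℝ × ℝ) u v → Linked _≤_ C → proj₁ y ≤ proj₂ y →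
  Stage C y x →
  (proj₁ x ≤ proj₂ x →
    (∀ o → movementCost y x + connectionCost C x + A.symmetricPotential o x ≤
           A.symmetricPotential o y + 63 · connectionCost C o) →
    u ≤ v) → u ≤ v
stage C (y₁ , y₂) (x₁ , x₂) u v sorted y₁≤y₂
  ((z₁ , z₂) , (w₁ , w₂ , if₁ , if₂ , if₃) , thenᵃ , elseᵃ) =
  S.stage {y₁ = y₁} {y₂} {w₁} {w₂} {z₁} {z₂} {x₁} {x₂} {u} {v}
    (toList-∷ C) (last-toList C) (sorted-toList sorted) y₁≤y₂ if₁ if₂ if₃
    (thenᵃ , λ ¬a → proj₁ (elseᵃ ¬a) , λ ¬b →
      let O₁ , O₂ , opt , med = proj₂ (elseᵃ ¬a) ¬b
      in O₁ , O₂ , (IsOptimalPartition.partition opt , IsOptimalPartition.minimal opt) , med)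

module Analysis {n T : ℕ} (I : Instance n T) (x y : Solution T)
  (initial-ordered : proj₁ (initial I) ≤ proj₂ (initial I))
  (algorithmic : ProducedByAlgorithm I x) where

  position : Solution T → Fin (suc T) → ℝ × ℝ
  position s = initial I Vector.∷ s

  stageCost : Solution T → Fin T → ℝ
  stageCost s t = movementCost (previous (initial I) s t) (s t) + connectionCost (agents I t) (s t)

  Φ : Fin (suc T) → ℝ
  Φ i = A.symmetricPotential (position y i) (position x i)

  facilities-ordered : ∀ i → proj₁ (position x i) ≤ proj₂ (position x i)
  facilities-ordered = <-weakInduction (λ i → proj₁ (position x i) ≤ proj₂ (position x i))
    initial-ordered
    -- The order of the new positions is itself an inequality, so it can be the goal of the
    -- continuation.
    (λ t before → stage (agents I t) (position x (inject₁ t)) (x t) (proj₁ (x t)) (proj₂ (x t))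
      (ordered I t) before (algorithmic t) (λ x₁≤x₂ _ → x₁≤x₂))

  stage-amortized : ∀ t → stageCost x t + Φ (suc t) ≤ Φ (inject₁ t) + 63 · stageCost y t
  stage-amortized t = stage (agents I t) (position x (inject₁ t)) (x t)
    (stageCost x t + Φ (suc t)) (Φ (inject₁ t) + 63 · stageCost y t)
    (ordered I t) (facilities-ordered (inject₁ t)) (algorithmic t)
    (λ _ bound → A.amortized-drift (connectionCost (agents I t) (y t)) {stageCost x t}
      (position y (inject₁ t)) (y t) (position x (inject₁ t)) (x t) (bound (y t)))

  total-amortized : Cost I x + Φ (fromℕ T) ≤ Φ zero + 63 · Cost I y
  total-amortized = A.telescope (stageCost x) (stageCost y) Φ stage-amortized

theorem4p1 : ∀ {n T : ℕ} (I : Instance n T) (x x* : Solution T) →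
    proj₁ (initial I) ≤ proj₂ (initial I) →
    ProducedByAlgorithm I x →
    IsOptimal I x* →
    Cost I x ≤ 63 · Cost I x* + ∣ proj₁ (initial I) - proj₂ (initial I) ∣
theorem4p1 {n} {T} I x x* initial-ordered algorithmic _ =
  A.initial-final {Cost I x} {63 · Cost I x*} (initial I)
    (position x* (fromℕ T)) (position x (fromℕ T))
    (facilities-ordered (fromℕ T)) total-amortized
  where open Analysis I x x* initial-ordered algorithmic
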